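{- For $n\ge2$, $p_n(\Sigma_2)=C(n,2)=L_2(n)$, where $L_2(n)=\frac1n\sum_{d\mid n}\mu(d)2^{n/d}$ and $\mu$ is the Möbius function.
   Context: For $\sigma\in\{+,-\}^k$ ($k\ge2$), let $\mathcal W_k$ be the set of infinite words over $\{0,\dots,k-1\}$ with the linear order $\prec_\sigma$: for $s\neq t$, with $j$ the first index where $s_j\neq t_j$ and $c=|\{i<j:\sigma_{s_i}=-\}|$, $s\prec_\sigma t$ iff ($c$ even and $s_j<t_j$) or ($c$ odd and $s_j>t_j$). The signed shift $\Sigma_\sigma$ deletes the first letter of a word. Let $\mathcal W_{k,n}$ be the set of words $(s_1\dots s_n)^\infty$ with $s_1\dots s_n$ primitive (not a power of a shorter word). For $s\in\mathcal W_{k,n}$ let $\Pi_\sigma(s)\in\mathcal S_n$ be the permutation with $\Pi_\sigma(s)_i<\Pi_\sigma(s)_j$ iff $s_is_{i+1}\dots\prec_\sigma s_js_{j+1}\dots$. Let $\mathcal P_n(\Sigma_\sigma)=\{\Pi_\sigma(s):s\in\mathcal W_{k,n}\}$ and $p_n(\Sigma_\sigma)=|\mathcal P_n(\Sigma_\sigma)|/n$ (the number of classes of $\mathcal P_n(\Sigma_\sigma)$ under cyclic rotation). $\Sigma_k$ denotes the $k$-shift $\Sigma_{+^k}$ (all signs $+$; then $\prec_\sigma$ is lexicographic order). $C(n,i)$ denotes the number of cyclic permutations ($n$-cycles) in $\mathcal S_n$ with exactly $i-1$ descents, a descent of $\tau$ being an $i\in[n-1]$ with $\tau_i>\tau_{i+1}$.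 -}

module Defs where

open import Data.Nat as ℕ using (ℕ; zero; suc; _+_; _*_; _∸_; _^_; _<_; _≤_; _%_; _/_)
open import Data.Nat.DivMod using (_mod_)
open import Data.Nat.Divisibility using (_∣_; _∣?_)
open import Data.Nat.Primality using (Prime; prime?)
open import Data.Fin as Fin using (Fin; toℕ; fromℕ<)
open import Data.Vec as Vec using (Vec; lookup; toList)
open import Data.List as List using (List; []; _∷_; length; filter; concat; replicate; map; upTo; foldr)
open import Data.Bool.ListAction using (any)
open import Data.List.Relation.Unary.Unique.Propositional using (Unique)
open import Data.List.Membership.Propositional using (_∈_)
open import Data.Integer as ℤ using (ℤ; +_)
open import Data.Product using (Σ; ∃; ∃-syntax; _×_)
open import Data.Bool using (if_then_else_)
open import Relation.Nullary using (¬_; does)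
open import Relation.Nullary.Decidable using (_×-dec_)
open import Relation.Binary.PropositionalEquality using (_≡_)
open import Function.Bundles using (_⇔_)

Letter : Set
Letter = Fin 2

InfWord : Set
InfWord = ℕ → Letter

-- Lexicographic order ≺ on infinite words (the order ≺_σ for σ = +^k:
-- the count c is always 0, hence even)
_≺_ : InfWord → InfWord → Set
s ≺ t = ∃[ j ] ((∀ i → i < j → s i ≡ t i) × toℕ (s j) < toℕ (t j))

Primitive : List Letter → Set
Primitive w = ¬ (∃[ u ] ∃[ m ] (2 ≤ m × w ≡ concat (replicate m u)))

-- (s_1 … s_n)^∞
-- (the n = 0 clause is a dummy; only n ≥ 2 is used)
periodic : ∀ {n} → Vec Letter n → InfWord
periodic {zero}  w j = Fin.zero
periodic {suc n} w j = lookup w (j mod suc n)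

shiftAt : ∀ {n} → Vec Letter n → ℕ → InfWord
shiftAt w i j = periodic w (i + j)

-- Permutations in S_n in one-line notation (entries 0-indexed)
IsPerm : ∀ {n} → Vec (Fin n) n → Set
IsPerm {n} v = ∀ (i j : Fin n) → lookup v i ≡ lookup v j → i ≡ j

IsPattern : ∀ {n} → Vec Letter n → Vec (Fin n) n → Set
IsPattern {n} w π = IsPerm π ×
  (∀ (i j : Fin n) → (lookup π i Fin.< lookup π j) ⇔ (shiftAt w (toℕ i) ≺ shiftAt w (toℕ j)))

InPn : ∀ n → Vec (Fin n) n → Set
InPn n π = ∃[ w ] (Primitive (toList w) × IsPattern {n} w π)

iter : ∀ {n} → Vec (Fin n) n → ℕ → Fin n → Fin n
iter v zero    x = x
iter v (suc k) x = lookup v (iter v k x)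

IsNCycle : ∀ {n} → Vec (Fin n) n → Set
IsNCycle {n} v = ∀ (x y : Fin n) → ∃[ k ] (iter v k x ≡ y)

desList : ∀ {n} → List (Fin n) → ℕ
desList []           = 0
desList (x ∷ [])     = 0
desList (x ∷ y ∷ xs) = (if does (y Fin.<? x) then 1 else 0) + desList (y ∷ xs)

des : ∀ {n} → Vec (Fin n) n → ℕ
des v = desList (toList v)

HasCard : ∀ n → (Vec (Fin n) n → Set) → ℕ → Set
HasCard n P m = Σ (List (Vec (Fin n) n)) λ xs →
  length xs ≡ m × Unique xs × (∀ v → (v ∈ xs) ⇔ P v)

-- Cyclic permutations with exactly i-1 descents (C(n,i) counts these)
CycDes : ∀ n → ℕ → Vec (Fin n) n → Set
CycDes n i v = IsPerm v × IsNCycle v × des v ≡ i ∸ 1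

primeDivisors : ℕ → List ℕ
primeDivisors d = filter (λ p → prime? p ×-dec (p ∣? d)) (upTo (suc d))

mobius : ℕ → ℤ
mobius d =
  if any (λ p → does (p * p ∣? d)) (primeDivisors d)
  then + 0
  else (if does (length (primeDivisors d) % 2 ℕ.≟ 0) then + 1 else ℤ.- (+ 1))

necklaceSum : ℕ → ℤ
necklaceSum n = foldr ℤ._+_ (+ 0)
  (map (λ k → if does (suc k ∣? n) then mobius (suc k) ℤ.* (+ (2 ^ (n / suc k))) else + 0)
       (upTo n))

{-# OPTIONS --safe #-}

-- Let π be the pattern of a primitive word w, and let τ be the cyclic permutation
-- π₁ → π₂ → … → πₙ → π₁.  Deleting equal first letters preserves the lexicographic
-- order, so τ is increasing on the ranks of the shifts starting with 0 and on those
-- starting with 1; being a cycle it is not the identity, hence it has exactly one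
-- descent, and the position of that descent recovers w.  Conversely, a cycle τ with one
-- descent and a starting point x determine a word, recording on which side of the
-- descent each τⁱ(x) lies, whose pattern is x, τ(x), τ²(x), ….  So the primitive words,
-- the patterns and the pairs (τ, x) are equinumerous, and Möbius inversion counts the
-- primitive words.
module Submission where

open import Defs
open import Algebra.Properties.CommutativeSemigroup using (interchange)
open import Data.Bool using (Bool; true; false; if_then_else_; T)
open import Data.Bool.ListAction using (any)
open import Data.Bool.Properties using (⇔→≡; T-≡)
open import Data.Fin as Fin using (Fin; toℕ; fromℕ<; punchOut)
open import Data.Fin.Subset as Subset using (Subset; ∣_∣)
open import Data.Integer as ℤ using (ℤ; +_)
open import Data.List as List using (List; []; _∷_; _++_; length; filter; concat; replicate; map; foldr; upTo; applyUpTo; allFin; cartesianProductWith; cartesianProduct; deduplicate)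
open import Data.List.Membership.Propositional using (_∈_; find; lose)
open import Data.List.Membership.Propositional.Properties
open import Data.List.Membership.Propositional.Properties.WithK using (unique∧set⇒bag)
open import Data.List.Properties using (map-upTo; length-map; length-++; length-tabulate)
open import Data.List.Relation.Binary.BagAndSetEquality using (∼bag⇒↭)
open import Data.List.Relation.Binary.Permutation.Propositional.Properties using (↭-length)
open import Data.List.Relation.Unary.All as All using ([]; _∷_)
open import Data.List.Relation.Unary.Any using (here; there)
open import Data.List.Relation.Unary.Any.Properties using (any⁺; any⁻)
open import Data.List.Relation.Unary.Unique.Propositional using (Unique; []; _∷_)
open import Data.Nat as ℕ using (ℕ; zero; suc; _+_; _*_; _∸_; _^_; _≤_; _<_; NonZero; z≤n; s≤s; _%_; _/_; _<?_; _≤?_)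
open import Data.Nat.Coprimality using (Coprime; coprime-divisor)
open import Data.Nat.Divisibility
open import Data.Nat.DivMod
open import Data.Nat.Primality using (Prime; prime?; prime⇒irreducible; prime⇒nonZero; euclidsLemma; ¬prime[1])
open import Data.Nat.Primality.Factorisation using (factorise)
open import Data.Product using (Σ; ∃-syntax; _×_; _,_; proj₁; proj₂)
open import Data.Sum using (_⊎_; inj₁; inj₂; [_,_])
open import Data.Unit using (⊤; tt)
open import Data.Vec as Vec using (Vec; []; _∷_; lookup; toList; tabulate)
open import Function using (_∘_; id)
open import Function.Bundles using (_⇔_; mk⇔; Equivalence)
open import Function.Definitions using (Injective)
open import Relation.Binary.Definitions using (DecidableEquality; tri<; tri≈; tri>)
open import Relation.Binary.PropositionalEquality hiding ([_])
open import Relation.Nullary using (¬_; Dec; yes; no; does; contradiction; ¬?)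
open import Relation.Nullary.Decidable using (_×-dec_; dec-true; dec-false; does-⇔; map′; decidable-stable)
open import Relation.Unary using (Decidable)
import Data.Fin.Properties as Fin
import Data.Fin.Subset.Properties as Subset
import Data.Integer
import Data.Integer.Properties as ℤ
import Data.List.Relation.Unary.All.Properties as All
import Data.List.Relation.Unary.Unique.DecPropositional.Properties as DecUnique
import Data.List.Relation.Unary.Unique.Propositional.Properties as Unique
import Data.Nat.Properties as ℕ
import Data.Vec.Properties as Vec

open Equivalence

-- Cardinalities

-- No formula for the number of cycles is derived. The patterns are enumerated twice, as images of
-- the primitive words and as pairs of a cycle and a starting point, and comparing the two lengths
-- ties the number `c` of cycles to the number of primitive words. That there are finitely many
-- cycles at all comes from their being images of patterns. The equation is kept as `n * c`, so
-- nothing has to be divided by `n`. Words and cycles meet in a cut of the ranks into two blocks, a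
-- `Labelling`: for a word it is the first letter as a function of the rank, for a cycle the side of
-- the descent. The delicate point is the converse direction: distinct points of a cycle must have
-- distinct itineraries, since both the primitivity of the word and the order of its shifts depend
-- on it. Equal itineraries would let one power of the cycle push a point upwards again and again,
-- although the orbit is finite and closes up.

private
  variable
    A B C : Set
    P Q : A → Set
    ∣P∣ ∣Q∣ : ℕ

-- `HasCard` over an arbitrary type, so that words and pairs can be counted too; on vectors the two
-- unfold to the same type.
Card : (A → Set) → ℕ → Set
Card {A} P m = Σ (List A) λ xs → length xs ≡ m × Unique xs × (∀ v → (v ∈ xs) ⇔ P v)

Unique-length : ∀ {xs ys : List A} → Unique xs → Unique ys →
                (∀ v → v ∈ xs ⇔ v ∈ ys) → length xs ≡ length ys
Unique-length ux uy eq = ↭-length (∼bag⇒↭ (unique∧set⇒bag ux uy (λ {v} → eq v)))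

Card-unique : ∀ {m n} → Card P m → Card P n → m ≡ n
Card-unique (xs , refl , ux , ex) (ys , refl , uy , ey) =
  Unique-length ux uy λ v → mk⇔ (from (ey v) ∘ to (ex v)) (from (ex v) ∘ to (ey v))

Unique-map : ∀ (f : A → B) {xs} → (∀ {x y} → x ∈ xs → y ∈ xs → f x ≡ f y → x ≡ y) →
             Unique xs → Unique (map f xs)
Unique-map f inj [] = []
Unique-map f inj (x∉ ∷ u) =
  All.map⁺ (All.tabulate λ y∈ eq → All.lookup x∉ y∈ (inj (here refl) (there y∈) eq))
  ∷ Unique-map f (λ x∈ y∈ → inj (there x∈) (there y∈)) u

Card-bijection : (f : A → B) → (∀ {x} → P x → Q (f x)) →
                 (∀ {x y} → P x → P y → f x ≡ f y → x ≡ y) →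
                 (∀ {y} → Q y → ∃[ x ] (P x × f x ≡ y)) →
                 Card P ∣P∣ → Card Q ∣P∣
Card-bijection {Q = Q} f pres inj sur (xs , len , u , e) =
  map f xs , trans (length-map f xs) len ,
  Unique-map f (λ x∈ y∈ → inj (to (e _) x∈) (to (e _) y∈)) u ,
  λ v → mk⇔ (λ v∈ → let x , x∈ , eq = ∈-map⁻ f v∈ in subst Q (sym eq) (pres (to (e x) x∈)))
            (λ q → let x , p , eq = sur q in subst (_∈ map f xs) eq (∈-map⁺ f (from (e x) p)))

-- Collisions are removed by deduplication, so only the existence of a count results; its value has
-- to be found otherwise.
Card-image : DecidableEquality B → (f : A → B) → (∀ {x} → P x → Q (f x)) →
             (∀ {y} → Q y → ∃[ x ] (P x × f x ≡ y)) →
             Card P ∣P∣ → ∃[ n ] Card Q n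
Card-image {Q = Q} _≟_ f pres sur (xs , len , u , e) =
  _ , deduplicate _≟_ (map f xs) , refl , DecUnique.deduplicate-! _≟_ (map f xs) ,
  λ v → mk⇔ (λ v∈ → let x , x∈ , eq = ∈-map⁻ f (∈-deduplicate⁻ _≟_ (map f xs) v∈)
                    in subst Q (sym eq) (pres (to (e x) x∈)))
            (λ q → let x , p , eq = sur q in ∈-deduplicate⁺ _≟_ (subst (_∈ map f xs) eq (∈-map⁺ f (from (e x) p))))

length-cartesianProductWith : ∀ (f : A → B → C) xs ys →
  length (cartesianProductWith f xs ys) ≡ length xs * length ys
length-cartesianProductWith f []       ys = refl
length-cartesianProductWith f (x ∷ xs) ys = trans (length-++ (map (f x) ys))
  (cong₂ _+_ (length-map (f x) ys) (length-cartesianProductWith f xs ys))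

Card-× : Card P ∣P∣ → Card Q ∣Q∣ → Card (λ (x , y) → P x × Q y) (∣P∣ * ∣Q∣)
Card-× (xs , refl , ux , ex) (ys , refl , uy , ey) =
  cartesianProduct xs ys , length-cartesianProductWith _,_ xs ys , Unique.cartesianProduct⁺ ux uy ,
  λ (x , y) → mk⇔ (λ xy∈ → let x∈ , y∈ = ∈-cartesianProduct⁻ xs ys xy∈ in to (ex x) x∈ , to (ey y) y∈)
                  (λ (p , q) → ∈-cartesianProduct⁺ (from (ex x) p) (from (ey y) q))

Card-Fin : ∀ n → Card {Fin n} (λ _ → ⊤) n
Card-Fin n = allFin n , length-tabulate id , Unique.allFin⁺ n , λ v → mk⇔ _ λ _ → ∈-allFin v

words : ∀ k n → List (Vec (Fin k) n)
words k zero    = List.[ [] ]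
words k (suc n) = cartesianProductWith _∷_ (allFin k) (words k n)

length-words : ∀ k n → length (words k n) ≡ k ^ n
length-words k zero    = refl
length-words k (suc n) = trans (length-cartesianProductWith _∷_ (allFin k) (words k n))
  (cong₂ _*_ (length-tabulate {n = k} id) (length-words k n))

∈-words : ∀ {k n} (w : Vec (Fin k) n) → w ∈ words k n
∈-words []      = here refl
∈-words (x ∷ w) = ∈-cartesianProductWith⁺ _∷_ (∈-allFin x) (∈-words w)

words-Unique : ∀ k n → Unique (words k n)
words-Unique k zero    = All.[] ∷ []
words-Unique k (suc n) = Unique.cartesianProductWith⁺ _∷_ Vec.∷-injective (Unique.allFin⁺ k) (words-Unique k n)

Card-words : ∀ k n → Card {Vec (Fin k) n} (λ _ → ⊤) (k ^ n)
Card-words k n = words k n , length-words k n , words-Unique k n , λ w → mk⇔ _ λ _ → ∈-words w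

Card-filter : ∀ {k n} {P : Vec (Fin k) n → Set} (P? : Decidable P) → Card P (length (filter P? (words k n)))
Card-filter {k} {n} P? = filter P? (words k n) , refl , Unique.filter⁺ P? (words-Unique k n) ,
  λ w → mk⇔ (λ w∈ → proj₂ (∈-filter⁻ P? {xs = words k n} w∈)) (∈-filter⁺ P? (∈-words w))

-- Finite sums of integers

∑ : ℕ → (ℕ → ℤ) → ℤ
∑ n f = foldr ℤ._+_ (+ 0) (applyUpTo f n)

∑ₗ : List A → (A → ℤ) → ℤ
∑ₗ xs f = foldr ℤ._+_ (+ 0) (map f xs)

∑-cong< : ∀ n {f g : ℕ → ℤ} → (∀ k → k < n → f k ≡ g k) → ∑ n f ≡ ∑ n g
∑-cong< zero    eq = refl
∑-cong< (suc n) eq = cong₂ ℤ._+_ (eq 0 (s≤s z≤n)) (∑-cong< n λ k k<n → eq (suc k) (s≤s k<n))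

∑-cong : ∀ n {f g : ℕ → ℤ} → (∀ k → f k ≡ g k) → ∑ n f ≡ ∑ n g
∑-cong n eq = ∑-cong< n λ k _ → eq k

∑-0 : ∀ n → ∑ n (λ _ → + 0) ≡ + 0
∑-0 zero    = refl
∑-0 (suc n) = trans (ℤ.+-identityˡ _) (∑-0 n)

∑-distrib-+ : ∀ n f g → ∑ n (λ k → f k ℤ.+ g k) ≡ ∑ n f ℤ.+ ∑ n g
∑-distrib-+ zero    f g = refl
∑-distrib-+ (suc n) f g = trans (cong (ℤ._+_ (f 0 ℤ.+ g 0)) (∑-distrib-+ n (f ∘ suc) (g ∘ suc)))
  (interchange ℤ.+-commutativeSemigroup (f 0) (g 0) _ _)

∑-distrib-neg : ∀ n f → ∑ n (λ k → ℤ.- f k) ≡ ℤ.- ∑ n f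
∑-distrib-neg zero    f = refl
∑-distrib-neg (suc n) f = trans (cong (ℤ._+_ (ℤ.- f 0)) (∑-distrib-neg n (f ∘ suc)))
  (sym (ℤ.neg-distrib-+ (f 0) _))

∑-split : ∀ m n f → ∑ (m + n) f ≡ ∑ m f ℤ.+ ∑ n (f ∘ (_+_ m))
∑-split zero    n f = sym (ℤ.+-identityˡ _)
∑-split (suc m) n f = trans (cong (ℤ._+_ (f 0)) (∑-split m n (f ∘ suc))) (sym (ℤ.+-assoc (f 0) _ _))

∑-extend : ∀ {m n} f → m ≤ n → (∀ k → m ≤ k → f k ≡ + 0) → ∑ n f ≡ ∑ m f
∑-extend {m} {n} f m≤n f≡0 = begin
  ∑ n f                                ≡⟨ cong (λ x → ∑ x f) (ℕ.m+[n∸m]≡n m≤n) ⟨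
  ∑ (m + (n ∸ m)) f                    ≡⟨ ∑-split m (n ∸ m) f ⟩
  ∑ m f ℤ.+ ∑ (n ∸ m) (f ∘ (_+_ m))    ≡⟨ cong (ℤ._+_ (∑ m f)) (∑-cong (n ∸ m) λ k → f≡0 (m + k) (ℕ.m≤m+n m k)) ⟩
  ∑ m f ℤ.+ ∑ (n ∸ m) (λ _ → + 0)      ≡⟨ cong (ℤ._+_ (∑ m f)) (∑-0 (n ∸ m)) ⟩
  ∑ m f ℤ.+ + 0                        ≡⟨ ℤ.+-identityʳ _ ⟩
  ∑ m f                                ∎
  where open ≡-Reasoning

-- Cut the range into `N` blocks of length `p`: in each block only the first index can be a multiple
-- of `p`.
∑-multiples : ∀ p .{{_ : NonZero p}} N f → (∀ d → ¬ p ∣ d → f d ≡ + 0) →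
              ∑ (N * p) f ≡ ∑ N (λ e → f (e * p))
∑-multiples p@(suc p′) zero    f f≡0 = refl
∑-multiples p@(suc p′) (suc N) f f≡0 = begin
  ∑ (p + N * p) f                            ≡⟨ ∑-split p (N * p) f ⟩
  f 0 ℤ.+ ∑ p′ (f ∘ suc) ℤ.+ ∑ (N * p) (f ∘ (_+_ p))
    ≡⟨ cong₂ (λ x y → f 0 ℤ.+ x ℤ.+ y)
         (trans (∑-cong< p′ λ k k<p′ → f≡0 (suc k) (>⇒∤ (s≤s k<p′))) (∑-0 p′))
         (∑-multiples p N (f ∘ (_+_ p)) λ d p∤d → f≡0 (p + d) λ p∣ → p∤d (∣m+n∣m⇒∣n p∣ ∣-refl)) ⟩
  f 0 ℤ.+ + 0 ℤ.+ ∑ N (λ e → f (suc e * p))  ≡⟨ cong (λ x → x ℤ.+ ∑ N (λ e → f (suc e * p))) (ℤ.+-identityʳ (f 0)) ⟩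
  f 0 ℤ.+ ∑ N (λ e → f (suc e * p))          ∎
  where open ≡-Reasoning

∑ₗ-cong : ∀ (xs : List A) {f g : A → ℤ} → (∀ x → f x ≡ g x) → ∑ₗ xs f ≡ ∑ₗ xs g
∑ₗ-cong []       eq = refl
∑ₗ-cong (x ∷ xs) eq = cong₂ ℤ._+_ (eq x) (∑ₗ-cong xs eq)

∑ₗ-0 : ∀ (xs : List A) → ∑ₗ xs (λ _ → + 0) ≡ + 0
∑ₗ-0 []       = refl
∑ₗ-0 (x ∷ xs) = trans (ℤ.+-identityˡ _) (∑ₗ-0 xs)

∑ₗ-∑-swap : ∀ (xs : List A) n (f : A → ℕ → ℤ) →
            ∑ₗ xs (λ x → ∑ n (f x)) ≡ ∑ n (λ k → ∑ₗ xs (λ x → f x k))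
∑ₗ-∑-swap []       n f = sym (∑-0 n)
∑ₗ-∑-swap (x ∷ xs) n f = trans (cong (ℤ._+_ (∑ n (f x))) (∑ₗ-∑-swap xs n f))
  (sym (∑-distrib-+ n (f x) _))

module _ {P : A → Set} (P? : ∀ x → Dec (P x)) where

  ∑ₗ-indicator : ∀ c xs → ∑ₗ xs (λ x → if does (P? x) then c else + 0) ≡ c ℤ.* + length (filter P? xs)
  ∑ₗ-indicator c []       = sym (ℤ.*-zeroʳ c)
  ∑ₗ-indicator c (x ∷ xs) with does (P? x)
  ... | true  = trans (cong (ℤ._+_ c) (∑ₗ-indicator c xs)) (sym (ℤ.*-suc c _))
  ... | false = trans (ℤ.+-identityˡ _) (∑ₗ-indicator c xs)

if-yes : ∀ {P : Set} (P? : Dec P) {x y : A} → P → (if does P? then x else y) ≡ x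
if-yes P? p rewrite dec-true P? p = refl

if-no : ∀ {P : Set} (P? : Dec P) {x y : A} → ¬ P → (if does P? then x else y) ≡ y
if-no P? ¬p rewrite dec-false P? ¬p = refl

if-⇔ : ∀ {P Q : Set} (P? : Dec P) (Q? : Dec Q) {x y : A} → P ⇔ Q →
       (if does P? then x else y) ≡ (if does Q? then x else y)
if-⇔ P? Q? P⇔Q = cong (if_then _ else _) (does-⇔ P⇔Q P? Q?)

-- The Möbius function

∈-primeDivisors : ∀ {q d} .{{_ : NonZero d}} → q ∈ primeDivisors d ⇔ (Prime q × q ∣ d)
∈-primeDivisors {q} {d} = mk⇔
  (λ q∈ → proj₂ (∈-filter⁻ (λ p → prime? p ×-dec (p ∣? d)) {xs = upTo (suc d)} q∈))
  (λ (pr , q∣d) → ∈-filter⁺ (λ p → prime? p ×-dec (p ∣? d)) (∈-upTo⁺ (s≤s (∣⇒≤ q∣d))) (pr , q∣d))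

primeDivisors-Unique : ∀ d → Unique (primeDivisors d)
primeDivisors-Unique d = Unique.filter⁺ (λ p → prime? p ×-dec (p ∣? d)) (Unique.upTo⁺ (suc d))

hasSquareFactor : ℕ → Bool
hasSquareFactor d = any (λ p → does (p * p ∣? d)) (primeDivisors d)

T-does : ∀ {P : Set} (P? : Dec P) → T (does P?) ⇔ P
T-does (yes p) = mk⇔ (λ _ → p) _
T-does (no ¬p) = mk⇔ (λ ()) ¬p

T-hasSquareFactor : ∀ {d} .{{_ : NonZero d}} → T (hasSquareFactor d) ⇔ (∃[ q ] (Prime q × q * q ∣ d))
T-hasSquareFactor {d} = mk⇔
  (λ t → let q , q∈ , sq = find (any⁻ _ (primeDivisors d) t)
         in q , proj₁ (to ∈-primeDivisors q∈) , to (T-does (q * q ∣? d)) sq)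
  (λ (q , pr , sq) → any⁺ _ (lose {P = λ q → T (does (q * q ∣? d))}
     (from ∈-primeDivisors (pr , ∣-trans (m∣m*n q) sq)) (from (T-does (q * q ∣? d)) sq)))

-- The power of -1 in exactly the form that `mobius` computes, so that `mobius` unfolds to it.
sign : ℕ → ℤ
sign k = if does (k % 2 ℕ.≟ 0) then + 1 else ℤ.- (+ 1)

sign-suc : ∀ k → sign (suc k) ≡ ℤ.- sign k
sign-suc zero          = refl
sign-suc (suc zero)    = refl
-- The remainder modulo 2 is unchanged by two successors by computation alone.
sign-suc (suc (suc k)) = sign-suc k

prime∣prime⇒≡ : ∀ {p q} → Prime p → Prime q → p ∣ q → p ≡ q
prime∣prime⇒≡ pp pq p∣q with prime⇒irreducible pq p∣q
... | inj₁ refl = contradiction pp ¬prime[1]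
... | inj₂ eq   = eq

prime∤⇒coprime : ∀ {p x} → Prime p → ¬ p ∣ x → Coprime x p
prime∤⇒coprime pp p∤x (d∣x , d∣p) with prime⇒irreducible pp d∣p
... | inj₁ eq   = eq
... | inj₂ refl = contradiction d∣x p∤x

mobius-square : ∀ {p d} .{{_ : NonZero d}} → Prime p → p * p ∣ d → mobius d ≡ + 0
mobius-square {p} {d} pp sq =
  cong (if_then + 0 else sign (length (primeDivisors d))) (to T-≡ (from T-hasSquareFactor (p , pp , sq)))

module _ {p e : ℕ} .{{_ : NonZero e}} (pp : Prime p) (p∤e : ¬ p ∣ e) where

  private
    instance
      p≢0 : NonZero p
      p≢0 = prime⇒nonZero pp
      ep≢0 : NonZero (e * p)
      ep≢0 = ℕ.m*n≢0 e p

  -- The square of `p` itself would leave a factor `p` in `e`; the square of any other prime is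
  -- coprime to `p`, hence divides `e`.
  hasSquareFactor-*-prime : hasSquareFactor (e * p) ≡ hasSquareFactor e
  hasSquareFactor-*-prime = ⇔→≡ (mk⇔
    (to T-≡ ∘ from T-hasSquareFactor ∘ ⇒ ∘ to T-hasSquareFactor ∘ from T-≡)
    (to T-≡ ∘ from T-hasSquareFactor ∘ ⇐ ∘ to T-hasSquareFactor ∘ from T-≡))
    where
    ⇒ : ∃[ q ] (Prime q × q * q ∣ e * p) → ∃[ q ] (Prime q × q * q ∣ e)
    ⇒ (q , pq , sq) with p ℕ.≟ q
    ... | yes refl = contradiction (*-cancelʳ-∣ p sq) p∤e
    ... | no p≢q   = q , pq , coprime-divisor (prime∤⇒coprime pp p∤q²) (subst (q * q ∣_) (ℕ.*-comm e p) sq)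
      where
      p∤q² : ¬ p ∣ q * q
      p∤q² = p≢q ∘ prime∣prime⇒≡ pp pq ∘ [ id , id ] ∘ euclidsLemma q q pp
    ⇐ : ∃[ q ] (Prime q × q * q ∣ e) → ∃[ q ] (Prime q × q * q ∣ e * p)
    ⇐ (q , pq , sq) = q , pq , ∣-trans sq (m∣m*n p)

  -- The one new prime divisor is `p`. Its place in the list is immaterial, as duplicate-free lists
  -- with the same members have equal length.
  length-primeDivisors-*-prime : length (primeDivisors (e * p)) ≡ suc (length (primeDivisors e))
  length-primeDivisors-*-prime = Unique-length (primeDivisors-Unique (e * p))
    (All.tabulate (λ q∈ p≡q → p∤e (subst (_∣ e) (sym p≡q) (proj₂ (to ∈-primeDivisors q∈)))) ∷ primeDivisors-Unique e)
    (λ q → mk⇔ (⇒ ∘ to ∈-primeDivisors) (from ∈-primeDivisors ∘ ⇐))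
    where
    ⇒ : ∀ {q} → Prime q × q ∣ e * p → q ∈ p ∷ primeDivisors e
    ⇒ (pq , q∣) with euclidsLemma e p pq q∣
    ... | inj₁ q∣e = there (from ∈-primeDivisors (pq , q∣e))
    ... | inj₂ q∣p = here (prime∣prime⇒≡ pq pp q∣p)
    ⇐ : ∀ {q} → q ∈ p ∷ primeDivisors e → Prime q × q ∣ e * p
    ⇐ (here refl) = pp , n∣m*n e
    ⇐ (there q∈)  = let pq , q∣e = to ∈-primeDivisors q∈ in pq , ∣-trans q∣e (m∣m*n p)

  mobius-*-prime : mobius (e * p) ≡ ℤ.- mobius e
  mobius-*-prime = trans
    (cong₂ (λ b k → if b then + 0 else sign k) hasSquareFactor-*-prime length-primeDivisors-*-prime)
    (lemma (hasSquareFactor e))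
    where
    lemma : ∀ b → (if b then + 0 else sign (suc (length (primeDivisors e)))) ≡
                  ℤ.- (if b then + 0 else sign (length (primeDivisors e)))
    lemma true  = refl
    lemma false = sign-suc (length (primeDivisors e))

primeDivisor : ∀ m → 2 ≤ m → ∃[ p ] (Prime p × p ∣ m)
primeDivisor m@(suc _) 2≤m with factorise m
... | record { factors = [] ; isFactorisation = eq } = contradiction 2≤m (ℕ.<⇒≱ (s≤s (ℕ.≤-reflexive eq)))
... | record { factors = p ∷ ps ; isFactorisation = eq ; factorsPrime = pp ∷ _ } =
  p , pp , subst (p ∣_) (sym eq) (m∣m*n _)

-- Vanishing off the divisors of `m` allows a divisor sum to run over any sufficiently long initial
-- range.
mobiusAt : ℕ → ℕ → ℤ
mobiusAt m d = if does (d ∣? m) then mobius d else + 0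

-- For a prime p ∣ m, the divisors d with p ∤ d cancel against p d, and the
-- multiples of p² contribute nothing.
∑-mobiusAt-0 : ∀ {p m} .{{_ : NonZero m}} → Prime p → p ∣ m → ∑ (suc m) (mobiusAt m) ≡ + 0
∑-mobiusAt-0 {p} {m} pp p∣m = begin
  -- Lengthening the range to `N * p` adds only zeros and makes its multiples of `p` exactly the
  -- `e * p` with `e < N`.
  ∑ N f                            ≡⟨ ∑-extend f N≤Np f-vanishes ⟨
  ∑ (N * p) f                      ≡⟨ ∑-cong (N * p) splits ⟩
  ∑ (N * p) (λ d → f₁ d ℤ.+ f₂ d)  ≡⟨ ∑-distrib-+ (N * p) f₁ f₂ ⟩
  ∑ (N * p) f₁ ℤ.+ ∑ (N * p) f₂
    ≡⟨ cong₂ ℤ._+_ (∑-extend f₁ N≤Np f₁-vanishes)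
         (trans (∑-multiples p N f₂ λ d p∤d → if-no (p ∣? d) p∤d) (trans (∑-cong N f₂-f₁) (∑-distrib-neg N f₁))) ⟩
  ∑ N f₁ ℤ.+ ℤ.- ∑ N f₁            ≡⟨ ℤ.+-inverseʳ (∑ N f₁) ⟩
  + 0                              ∎
  where
  open ≡-Reasoning
  instance
    p≢0 : NonZero p
    p≢0 = prime⇒nonZero pp
  N = suc m
  f f₁ f₂ : ℕ → ℤ
  f = mobiusAt m
  f₁ d = if does (p ∣? d) then + 0 else f d
  f₂ d = if does (p ∣? d) then f d else + 0
  N≤Np : N ≤ N * p
  N≤Np = ℕ.m≤m*n N p
  f-vanishes : ∀ d → N ≤ d → f d ≡ + 0
  f-vanishes d N≤d = if-no (d ∣? m) (>⇒∤ N≤d)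
  f₁-vanishes : ∀ d → N ≤ d → f₁ d ≡ + 0
  f₁-vanishes d N≤d with does (p ∣? d)
  ... | true  = refl
  ... | false = f-vanishes d N≤d
  splits : ∀ d → f d ≡ f₁ d ℤ.+ f₂ d
  splits d with does (p ∣? d)
  ... | true  = sym (ℤ.+-identityˡ (f d))
  ... | false = sym (ℤ.+-identityʳ (f d))
  0∤m : ¬ 0 ∣ m
  0∤m 0∣m = ℕ.≢-nonZero⁻¹ m (0∣⇒≡0 0∣m)
  f₂-f₁ : ∀ e → f₂ (e * p) ≡ ℤ.- f₁ e
  -- Index 0 lies in the range: it contributes nothing to `f₂` because 0 does not divide `m`, and
  -- nothing to `f₁` because `p` divides 0.
  f₂-f₁ zero = trans (if-yes (p ∣? 0) (p ∣0)) (trans (if-no (0 ∣? m) 0∤m) (cong ℤ.-_ (sym (if-yes (p ∣? 0) (p ∣0)))))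
  f₂-f₁ e@(suc _) = trans (if-yes (p ∣? e * p) (n∣m*n e)) (lemma (p ∣? e))
    where
    instance
      ep≢0 : NonZero (e * p)
      ep≢0 = ℕ.m*n≢0 e p
    lemma : (p∣?e : Dec (p ∣ e)) → f (e * p) ≡ ℤ.- (if does p∣?e then + 0 else f e)
    lemma (yes p∣e) with does (e * p ∣? m)
    ... | true  = mobius-square pp (*-monoˡ-∣ p p∣e)
    ... | false = refl
    lemma (no p∤e) = trans (if-⇔ (e * p ∣? m) (e ∣? m) (mk⇔ (∣-trans (m∣m*n p)) ep∣m)) (rest (does (e ∣? m)))
      where
      ep∣m : e ∣ m → e * p ∣ m
      -- The prime `p` divides `m`, which is `q * e`, but not `e`; so it divides the cofactor `q`.
      ep∣m (divides q m≡qe) = subst (e * p ∣_) (trans (ℕ.*-comm e q) (sym m≡qe))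
        (*-monoʳ-∣ e ([ id , (λ p∣e → contradiction p∣e p∤e) ] (euclidsLemma q e pp (subst (p ∣_) m≡qe p∣m))))
      rest : ∀ b → (if b then mobius (e * p) else + 0) ≡ ℤ.- (if b then mobius e else + 0)
      rest true  = mobius-*-prime pp p∤e
      rest false = refl

∑-mobius : ∀ m {n} .{{_ : NonZero m}} → m ≤ n →
           ∑ n (λ k → mobiusAt m (suc k)) ≡ (if does (m ℕ.≟ 1) then + 1 else + 0)
∑-mobius m {n} m≤n = trans
  (∑-extend (λ k → mobiusAt m (suc k)) m≤n (λ k m≤k → if-no (suc k ∣? m) (>⇒∤ (s≤s m≤k)))) (lemma m)
  where
  lemma : ∀ m .{{_ : NonZero m}} → ∑ m (λ k → mobiusAt m (suc k)) ≡ (if does (m ℕ.≟ 1) then + 1 else + 0)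
  lemma (suc zero)      = refl
  lemma m@(suc (suc _)) = let p , pp , p∣m = primeDivisor m (s≤s (s≤s z≤n)) in
    -- The divisors are indexed from 1 here and from 0 in `∑-mobiusAt-0`; the extra term at 0
    -- computes to zero.
    trans (sym (ℤ.+-identityˡ _)) (∑-mobiusAt-0 pp p∣m)

-- Periodic words

search : ∀ {P : ℕ → Set} → Decidable P → ∀ b →
         (∃[ m ] (m < b × P m × (∀ k → k < m → ¬ P k))) ⊎ (∀ k → k < b → ¬ P k)
search P? zero = inj₂ λ _ ()
search P? (suc b) with search P? b
... | inj₁ (m , m<b , p , least) = inj₁ (m , ℕ.m<n⇒m<1+n m<b , p , least)
... | inj₂ none with P? b
...   | yes p = inj₁ (b , ℕ.≤-refl , p , none)
...   | no ¬p = inj₂ λ k k<1+b → lemma k (ℕ.m≤n⇒m<n∨m≡n (ℕ.≤-pred k<1+b))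
  where
  lemma : ∀ k → k < b ⊎ k ≡ b → ¬ _
  lemma k (inj₁ k<b)  = none k k<b
  lemma k (inj₂ refl) = ¬p

lookup-ext : ∀ {A : Set} {n} {v v′ : Vec A n} → (∀ i → lookup v i ≡ lookup v′ i) → v ≡ v′
lookup-ext {v = v} {v′} eq = trans (sym (Vec.tabulate∘lookup v)) (trans (Vec.tabulate-cong eq) (Vec.tabulate∘lookup v′))

%-+ˡ : ∀ a b n .{{_ : NonZero n}} → (a % n + b) % n ≡ (a + b) % n
%-+ˡ a b n = trans (%-distribˡ-+ (a % n) b n)
  (trans (cong (λ x → (x + b % n) % n) (m%n%n≡m%n a n)) (sym (%-distribˡ-+ a b n)))

mod-cong : ∀ a b n .{{_ : NonZero n}} → a % n ≡ b % n → a mod n ≡ b mod n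
mod-cong a b n eq = Fin.fromℕ<-cong _ _ eq _ _

toℕ-mod : ∀ a n .{{_ : NonZero n}} → toℕ (a mod n) ≡ a % n
toℕ-mod a n = Fin.toℕ-fromℕ< (m%n<n a n)

mod-toℕ : ∀ {n} (i : Fin (suc n)) → toℕ i mod suc n ≡ i
mod-toℕ {n} i = Fin.toℕ-injective (trans (toℕ-mod (toℕ i) (suc n)) (m<n⇒m%n≡m (Fin.toℕ<n i)))

-- Zero is a period of every word, whence the positivity conditions wherever a shortest period
-- matters.
Period : InfWord → ℕ → Set
Period s p = ∀ i → s (i + p) ≡ s i

Period-* : ∀ {s p} → Period s p → ∀ k i → s (i + k * p) ≡ s i
Period-* {s} per zero    i = cong s (ℕ.+-identityʳ i)
Period-* {s} {p} per (suc k) i = trans (cong s (sym (ℕ.+-assoc i p (k * p))))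
  (trans (Period-* per k (i + p)) (per i))

Period-% : ∀ {s p} .{{_ : NonZero p}} → Period s p → ∀ i → s (i % p) ≡ s i
Period-% {s} {p} per i = trans (sym (Period-* per (i / p) (i % p))) (cong s (sym (m≡m%n+[m/n]*n i p)))

prefix : InfWord → ∀ n → Vec Letter n
prefix s n = tabulate (s ∘ toℕ)

periodic-prefix : ∀ s n j → periodic (prefix s (suc n)) j ≡ s (j % suc n)
periodic-prefix s n j = trans (Vec.lookup∘tabulate (s ∘ toℕ) (j mod suc n)) (cong s (toℕ-mod j (suc n)))

module _ {n : ℕ} where

  private N = suc n

  periodic-cong : ∀ (w : Vec Letter N) a b → a % N ≡ b % N → periodic w a ≡ periodic w b
  periodic-cong w a b eq = cong (lookup w) (mod-cong a b N eq)

  periodic-Period : ∀ (w : Vec Letter N) → Period (periodic w) N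
  periodic-Period w i = periodic-cong w (i + N) i ([m+n]%n≡m%n i N)

  periodic-toℕ : ∀ (w : Vec Letter N) i → periodic w (toℕ i) ≡ lookup w i
  periodic-toℕ w i = cong (lookup w) (mod-toℕ i)

  periodic-injective : ∀ {w w′ : Vec Letter N} → (∀ i → periodic w i ≡ periodic w′ i) → w ≡ w′
  periodic-injective {w} {w′} eq = lookup-ext λ i →
    trans (sym (periodic-toℕ w i)) (trans (eq (toℕ i)) (periodic-toℕ w′ i))

  -- One full turn of `N` indices decides, since both sides depend on the index only modulo `N`.
  period? : ∀ (w : Vec Letter N) p → Dec (Period (periodic w) p)
  period? w p = map′ extend (λ per i → per (toℕ i))
    (Fin.all? λ i → periodic w (toℕ i + p) Fin.≟ periodic w (toℕ i))
    where
    extend : (∀ (i : Fin N) → periodic w (toℕ i + p) ≡ periodic w (toℕ i)) → Period (periodic w) p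
    extend per i = begin
      periodic w (i + p)               ≡⟨ periodic-cong w (i % N + p) (i + p) (%-+ˡ i p N) ⟨
      periodic w (i % N + p)           ≡⟨ cong (λ x → periodic w (x + p)) (toℕ-mod i N) ⟨
      periodic w (toℕ (i mod N) + p)   ≡⟨ per (i mod N) ⟩
      periodic w (toℕ (i mod N))       ≡⟨ cong (periodic w) (toℕ-mod i N) ⟩
      periodic w (i % N)               ≡⟨ periodic-cong w (i % N) i (m%n%n≡m%n i N) ⟩
      periodic w i                     ∎
      where open ≡-Reasoning

  -- Take the least positive period `q`. For any period `p` the remainder `p % q` is again a period,
  -- and being smaller than `q` it is zero.
  minimalPeriod : ∀ (w : Vec Letter N) → ∃[ q ] (NonZero q × (∀ p → Period (periodic w) p ⇔ q ∣ p))
  minimalPeriod w with search (λ q → (0 <? q) ×-dec period? w q) (suc N)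
  ... | inj₂ none = contradiction (s≤s z≤n , periodic-Period w) (none N ℕ.≤-refl)
  ... | inj₁ (q@(suc _) , _ , (_ , per) , least) = q , _ , λ p → mk⇔ (m%n≡0⇒n∣m p q ∘ rem≡0 p)
        (λ { (divides k refl) → Period-* per k })
    where
    open ≡-Reasoning
    rem-Period : ∀ p → Period (periodic w) p → Period (periodic w) (p % q)
    rem-Period p perp i = begin
      periodic w (i + p % q)               ≡⟨ Period-* per (p / q) (i + p % q) ⟨
      periodic w (i + p % q + p / q * q)   ≡⟨ cong (periodic w) (ℕ.+-assoc i (p % q) (p / q * q)) ⟩
      periodic w (i + (p % q + p / q * q)) ≡⟨ cong (λ x → periodic w (i + x)) (m≡m%n+[m/n]*n p q) ⟨
      periodic w (i + p)                   ≡⟨ perp i ⟩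
      periodic w i                         ∎
    rem≡0 : ∀ p → Period (periodic w) p → p % q ≡ 0
    rem≡0 p perp with p % q | m%n<n p q | rem-Period p perp
    ... | zero  | _   | _    = refl
    ... | suc r | r<q | perr = contradiction (s≤s z≤n , perr) (least (suc r) r<q)

module _ {n : ℕ} where

  private N = suc n

  periodic-extend : ∀ {r} (u : Vec Letter (suc r)) → suc r ∣ N →
                    ∀ j → periodic (prefix (periodic u) N) j ≡ periodic u j
  periodic-extend {r} u r∣N j = trans (periodic-prefix (periodic u) n j)
    (periodic-cong u (j % N) j (m∣n⇒o%n%m≡o%m (suc r) N j r∣N))

  -- The first `r` letters are free and determine the rest; this is the origin of the powers of 2 in
  -- the necklace sum.
  Card-Period : ∀ r → r ∣ N → Card (λ (w : Vec Letter N) → Period (periodic w) r) (2 ^ r)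
  Card-Period zero      0∣N = contradiction (0∣⇒≡0 0∣N) λ ()
  Card-Period r@(suc r′) r∣N = Card-bijection (λ u → prefix (periodic u) N)
    (λ {u} _ i → trans (ext u (i + r)) (trans (periodic-Period u i) (sym (ext u i))))
    (λ {u} {u′} _ _ eq → periodic-injective λ i → trans (sym (ext u i)) (trans (cong (λ w → periodic w i) eq) (ext u′ i)))
    (λ {w} per → prefix (periodic w) r , _ , periodic-injective λ i →
       trans (ext (prefix (periodic w) r) i) (trans (periodic-prefix (periodic w) r′ i) (Period-% per i)))
    (Card-words 2 r)
    where
    ext = λ (u : Vec Letter r) → periodic-extend u r∣N

-- Primitive words

-- junk value zero past the end of the list
nth : List Letter → ℕ → Letter
nth []       i       = Fin.zero
nth (x ∷ xs) zero    = x
nth (x ∷ xs) (suc i) = nth xs i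

nth-toList : ∀ {n} (w : Vec Letter n) i → nth (toList w) (toℕ i) ≡ lookup w i
nth-toList (x Vec.∷ w) Fin.zero    = refl
nth-toList (x Vec.∷ w) (Fin.suc i) = nth-toList w i

nth-++ˡ : ∀ xs ys {i} → i < length xs → nth (xs ++ ys) i ≡ nth xs i
nth-++ˡ (x ∷ xs) ys {zero}  _         = refl
nth-++ˡ (x ∷ xs) ys {suc i} (s≤s i<) = nth-++ˡ xs ys i<

nth-++ʳ : ∀ xs ys i → nth (xs ++ ys) (length xs + i) ≡ nth ys i
nth-++ʳ []       ys i = refl
nth-++ʳ (x ∷ xs) ys i = nth-++ʳ xs ys i

nth-ext : ∀ xs ys → length xs ≡ length ys → (∀ i → i < length xs → nth xs i ≡ nth ys i) → xs ≡ ys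
nth-ext []       []       _  _  = refl
nth-ext (x ∷ xs) (y ∷ ys) le eq = cong₂ _∷_ (eq 0 (s≤s z≤n))
  (nth-ext xs ys (ℕ.suc-injective le) λ i i< → eq (suc i) (s≤s i<))

length-power : ∀ {A : Set} m (u : List A) → length (concat (replicate m u)) ≡ m * length u
length-power zero    u = refl
length-power (suc m) u = trans (length-++ u) (cong (_+_ (length u)) (length-power m u))

nth-power : ∀ m u .{{_ : NonZero (length u)}} i → i < m * length u →
            nth (concat (replicate m u)) i ≡ nth u (i % length u)
nth-power (suc m) u i i< with i <? length u
... | yes i<u = trans (nth-++ˡ u _ i<u) (cong (nth u) (sym (m<n⇒m%n≡m i<u)))
... | no i≮u with ℕ.m≤n⇒∃[o]m+o≡n (ℕ.≮⇒≥ i≮u)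
...   | j , refl = begin
  nth (u ++ concat (replicate m u)) (length u + j) ≡⟨ nth-++ʳ u _ j ⟩
  nth (concat (replicate m u)) j                   ≡⟨ nth-power m u j (ℕ.+-cancelˡ-< (length u) j _ i<) ⟩
  nth u (j % length u)                             ≡⟨ cong (nth u) ([m+n]%n≡m%n j (length u)) ⟨
  nth u ((j + length u) % length u)                ≡⟨ cong (λ x → nth u (x % length u)) (ℕ.+-comm j (length u)) ⟩
  nth u ((length u + j) % length u)                ∎
  where open ≡-Reasoning

length-toList : ∀ {A : Set} {n} (w : Vec A n) → length (toList w) ≡ n
length-toList Vec.[]      = refl
length-toList (x Vec.∷ w) = cong suc (length-toList w)

nth-toList-periodic : ∀ {n} (w : Vec Letter (suc n)) j → nth (toList w) (j % suc n) ≡ periodic w j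
nth-toList-periodic {n} w j = trans (cong (nth (toList w)) (sym (toℕ-mod j (suc n)))) (nth-toList w (j mod suc n))

-- Primitivity as the absence of shorter periods

module _ {n : ℕ} (w : Vec Letter (suc n)) where

  private N = suc n

  -- All shorter periods are excluded, not only those dividing `N`: coinciding shifts yield the
  -- difference of two positions, which may be any number below `N`.
  Aperiodic : Set
  Aperiodic = ∀ p → 0 < p → p < N → ¬ Period (periodic w) p

  aperiodic⇒primitive : Aperiodic → Primitive (toList w)
  aperiodic⇒primitive ap (u , m , 2≤m , w≡uᵐ) = lemma u w≡uᵐ
    where
    N≡ : ∀ u → toList w ≡ concat (replicate m u) → N ≡ m * length u
    N≡ u eq = trans (sym (length-toList w)) (trans (cong length eq) (length-power m u))
    lemma : ∀ u → toList w ≡ concat (replicate m u) → _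
    lemma [] eq = contradiction (trans (N≡ [] eq) (ℕ.*-zeroʳ m)) λ ()
    lemma u@(_ ∷ _) eq = ap p (s≤s z≤n) p<N λ i →
      trans (s-p (i + p)) (trans (cong (nth u) ([m+n]%n≡m%n i p)) (sym (s-p i)))
      where
      p = length u
      p<N : p < N
      p<N = ℕ.<-≤-trans (ℕ.m<m+n p (s≤s z≤n))
        (ℕ.≤-trans (ℕ.≤-reflexive (cong (_+_ p) (sym (ℕ.+-identityʳ p))))
          (ℕ.≤-trans (ℕ.*-monoˡ-≤ p 2≤m) (ℕ.≤-reflexive (sym (N≡ u eq)))))
      s-p : ∀ j → periodic w j ≡ nth u (j % p)
      s-p j = begin
        periodic w j                           ≡⟨ nth-toList-periodic w j ⟨
        nth (toList w) (j % N)                 ≡⟨ cong (λ x → nth x (j % N)) eq ⟩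
        nth (concat (replicate m u)) (j % N)   ≡⟨ nth-power m u (j % N) (subst (j % N <_) (N≡ u eq) (m%n<n j N)) ⟩
        nth u (j % N % p)                      ≡⟨ cong (nth u) (m∣n⇒o%n%m≡o%m p N j (divides m (N≡ u eq))) ⟩
        nth u (j % p)                          ∎
        where open ≡-Reasoning

  primitive⇒¬Period : Primitive (toList w) → ∀ p → p ∣ N → p < N → ¬ Period (periodic w) p
  primitive⇒¬Period prim zero 0∣N _ _ = contradiction (0∣⇒≡0 0∣N) λ ()
  primitive⇒¬Period prim p@(suc p′) (divides m N≡mp) p<N per =
    prim (u , m , 2≤m m N≡mp , nth-ext (toList w) _ same-length λ i i< → same i (subst (i <_) (length-toList w) i<))
    where
    u = toList (prefix (periodic w) p)
    2≤m : ∀ m → N ≡ m * p → 2 ≤ m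
    2≤m (suc zero)    eq = contradiction p<N (ℕ.<-irrefl (sym (trans eq (ℕ.+-identityʳ p))))
    2≤m (suc (suc m)) eq = s≤s (s≤s z≤n)
    |u|≡p : length u ≡ p
    |u|≡p = length-toList (prefix (periodic w) p)
    same-length : length (toList w) ≡ length (concat (replicate m u))
    same-length = trans (length-toList w) (trans N≡mp (trans (cong (m *_) (sym |u|≡p)) (sym (length-power m u))))
    same : ∀ i → i < N → nth (toList w) i ≡ nth (concat (replicate m u)) i
    same i i<N = begin
      nth (toList w) i                ≡⟨ cong (nth (toList w)) (m<n⇒m%n≡m i<N) ⟨
      nth (toList w) (i % N)          ≡⟨ nth-toList-periodic w i ⟩
      periodic w i                    ≡⟨ Period-% per i ⟨
      periodic w (i % p)              ≡⟨ periodic-prefix (periodic w) p′ i ⟨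
      periodic (prefix (periodic w) p) i
                                      ≡⟨ nth-toList-periodic (prefix (periodic w) p) i ⟨
      nth u (i % p)                   ≡⟨ cong (nth u) (%-congʳ {o = i} |u|≡p) ⟨
      nth u (i % length u)            ≡⟨ nth-power m u i (subst (i <_) (trans N≡mp (cong (m *_) (sym |u|≡p))) i<N) ⟨
      nth (concat (replicate m u)) i  ∎
      where open ≡-Reasoning

  -- A period `p` need not divide `N`, but the minimal period divides both, and a proper divisor of
  -- `N` that is a period splits the word into equal blocks.
  primitive⇒aperiodic : Primitive (toList w) → Aperiodic
  primitive⇒aperiodic prim p 0<p p<N per =
    let q , _ , q-min = minimalPeriod w
        instance p≢0 = ℕ.>-nonZero 0<p
    in primitive⇒¬Period prim q (to (q-min N) (periodic-Period w))
         (ℕ.≤-<-trans (∣⇒≤ (to (q-min p) per)) p<N) (from (q-min q) ∣-refl)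

  -- Let `q` be the minimal period and `m` the quotient of `N` by `q`. For a divisor `d` of `N`, the
  -- number `N / d` is a period iff `q` divides it, that is, iff `d` divides `m`. So the sum is that
  -- of the Möbius function over the divisors of `m`, and `m` is 1 exactly for primitive words.
  ∑-periods : ∃[ m ] (∑ N (λ k → if does (suc k ∣? N)
                  then (if does (period? w (N / suc k)) then mobius (suc k) else + 0) else + 0)
                ≡ (if does (m ℕ.≟ 1) then + 1 else + 0)
              × (m ≡ 1 ⇔ Primitive (toList w)))
  ∑-periods with minimalPeriod w
  ... | q , q≢0 , q-min with to (q-min N) (periodic-Period w)
  ...   | divides m N≡mq = m , trans (∑-cong N term) (∑-mobius m {{m≢0 m N≡mq}} m≤N) , mk⇔ ⇒ ⇐
    where
    instance
      _ = q≢0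
    m≢0 : ∀ m → N ≡ m * q → NonZero m
    m≢0 (suc m) _ = _
    m≤N : m ≤ N
    m≤N = subst (m ≤_) (sym N≡mq) (ℕ.m≤m*n m q)
    ⇒ : m ≡ 1 → Primitive (toList w)
    ⇒ refl = aperiodic⇒primitive λ p 0<p p<N per →
      contradiction p<N (ℕ.≤⇒≯ (subst (_≤ p) (sym (trans N≡mq (ℕ.+-identityʳ q)))
        (∣⇒≤ {{ℕ.>-nonZero 0<p}} (to (q-min p) per))))
    ⇐ : Primitive (toList w) → m ≡ 1
    ⇐ prim with ℕ.m≤n⇒m<n∨m≡n (subst (q ≤_) (sym N≡mq) (ℕ.m≤n*m q m {{m≢0 m N≡mq}}))
    ... | inj₁ q<N  = contradiction (from (q-min q) ∣-refl) (primitive⇒¬Period prim q (divides m N≡mq) q<N)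
    ... | inj₂ q≡N = ℕ.*-cancelʳ-≡ m 1 q (trans (sym N≡mq) (trans (sym q≡N) (sym (ℕ.+-identityʳ q))))
    term : ∀ k → (if does (suc k ∣? N)
                  then (if does (period? w (N / suc k)) then mobius (suc k) else + 0) else + 0)
               ≡ mobiusAt m (suc k)
    term k = lemma (suc k ∣? N)
      where
      d = suc k
      lemma : (d∣?N : Dec (d ∣ N)) →
              (if does d∣?N then (if does (period? w (N / d)) then mobius d else + 0) else + 0) ≡ mobiusAt m d
      lemma (no d∤N) = sym (if-no (d ∣? m) λ d∣m → d∤N (subst (d ∣_) (sym N≡mq) (∣-trans d∣m (m∣m*n q))))
      lemma (yes (divides r N≡rd)) = if-⇔ (period? w (N / d)) (d ∣? m)
            (mk⇔ (λ per → a (to (q-min r) (subst (Period (periodic w)) N/d≡r per)))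
                 (λ d∣m → subst (Period (periodic w)) (sym N/d≡r) (from (q-min r) (b d∣m))))
        where
        N/d≡r : N / d ≡ r
        N/d≡r = trans (cong (_/ d) N≡rd) (m*n/n≡m r d)
        -- Both directions cancel a factor in `r * d ≡ N ≡ m * q`.
        a : q ∣ r → d ∣ m
        a q∣r = *-cancelʳ-∣ q (subst (d * q ∣_) (trans (ℕ.*-comm d r) (trans (sym N≡rd) N≡mq)) (*-monoʳ-∣ d q∣r))
        b : d ∣ m → q ∣ r
        b d∣m = *-cancelʳ-∣ d (subst (q * d ∣_) (trans (ℕ.*-comm q m) (trans (sym N≡mq) N≡rd)) (*-monoʳ-∣ q d∣m))

-- The definition quantifies over all lists and exponents; the quotient of the length by the minimal
-- period reduces it to one test.
primitive? : ∀ {n} (w : Vec Letter (suc n)) → Dec (Primitive (toList w))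
primitive? w = let m , _ , m≡1⇔prim = ∑-periods w in map′ (to m≡1⇔prim) (from m≡1⇔prim) (m ℕ.≟ 1)

-- Writing μ(d) 2^(n/d) as a sum over the words of period n/d and exchanging the
-- summations, every word contributes ∑ μ(d) over the divisors d of n/q, where q is
-- its minimal period.
necklaceSum-counts-primitive : ∀ n → necklaceSum (suc n) ≡ + length (filter primitive? (words 2 (suc n)))
necklaceSum-counts-primitive n = begin
  necklaceSum N                                  ≡⟨ cong (foldr ℤ._+_ (+ 0)) (map-upTo G N) ⟩
  ∑ N G                                          ≡⟨ ∑-cong N term ⟩
  ∑ N (λ k → ∑ₗ (words 2 N) (λ w → F w k))       ≡⟨ ∑ₗ-∑-swap (words 2 N) N F ⟨
  ∑ₗ (words 2 N) (λ w → ∑ N (F w))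
    ≡⟨ ∑ₗ-cong (words 2 N) (λ w → let m , eq , m≡1⇔prim = ∑-periods w in
         trans eq (if-⇔ (m ℕ.≟ 1) (primitive? w) m≡1⇔prim)) ⟩
  ∑ₗ (words 2 N) (λ w → if does (primitive? w) then + 1 else + 0)
                                                 ≡⟨ ∑ₗ-indicator primitive? (+ 1) (words 2 N) ⟩
  + 1 ℤ.* + length (filter primitive? (words 2 N)) ≡⟨ ℤ.*-identityˡ _ ⟩
  + length (filter primitive? (words 2 N))       ∎
  where
  open ≡-Reasoning
  N = suc n
  G : ℕ → ℤ
  G k = if does (suc k ∣? N) then mobius (suc k) ℤ.* (+ (2 ^ (N / suc k))) else + 0
  F : Vec Letter N → ℕ → ℤ
  F w k = if does (suc k ∣? N) then (if does (period? w (N / suc k)) then mobius (suc k) else + 0) else + 0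
  term : ∀ k → G k ≡ ∑ₗ (words 2 N) (λ w → F w k)
  term k = lemma (suc k ∣? N)
    where
    d = suc k
    lemma : (d∣?N : Dec (d ∣ N)) →
            (if does d∣?N then mobius d ℤ.* (+ (2 ^ (N / d))) else + 0) ≡
            ∑ₗ (words 2 N) (λ w → if does d∣?N then (if does (period? w (N / d)) then mobius d else + 0) else + 0)
    lemma (no _)    = sym (∑ₗ-0 (words 2 N))
    lemma (yes d∣N) = sym (trans (∑ₗ-indicator (λ w → period? w (N / d)) (mobius d) (words 2 N))
      (cong (λ x → mobius d ℤ.* + x)
        (Card-unique (Card-filter (λ w → period? w (N / d))) (Card-Period (N / d) (m/n∣m d∣N)))))

-- The lexicographic order

≺-irrefl : ∀ {s t} → (∀ k → s k ≡ t k) → ¬ s ≺ t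
≺-irrefl eq (j , _ , lt) = ℕ.<-irrefl (cong toℕ (eq j)) lt

≺-trans : ∀ {s t u} → s ≺ t → t ≺ u → s ≺ u
≺-trans {s} {t} {u} (j , eq , lt) (k , eq′ , lt′) with ℕ.<-cmp j k
... | tri< j<k _ _ = j , (λ i i<j → trans (eq i i<j) (eq′ i (ℕ.<-trans i<j j<k))) ,
                     subst (λ x → toℕ (s j) < toℕ x) (eq′ j j<k) lt
... | tri≈ _ refl _ = j , (λ i i<j → trans (eq i i<j) (eq′ i i<j)) , ℕ.<-trans lt lt′
... | tri> _ _ k<j = k , (λ i i<k → trans (eq i (ℕ.<-trans i<k k<j)) (eq′ i i<k)) ,
                     subst (λ x → toℕ x < toℕ (u k)) (sym (eq k k<j)) lt′

≺-asym : ∀ {s t} → s ≺ t → ¬ t ≺ s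
≺-asym p q = ≺-irrefl (λ _ → refl) (≺-trans p q)

≺-resp : ∀ {s s′ t t′} → (∀ k → s k ≡ s′ k) → (∀ k → t k ≡ t′ k) → s ≺ t → s′ ≺ t′
≺-resp es et (j , eq , lt) = j , (λ i i<j → trans (sym (es i)) (trans (eq i i<j) (et i))) ,
  subst₂ (λ x y → toℕ x < toℕ y) (es j) (et j) lt

≺-head : ∀ {s t} → s ≺ t → toℕ (s 0) ≤ toℕ (t 0)
≺-head (zero  , _  , lt) = ℕ.<⇒≤ lt
≺-head (suc j , eq , _)  = ℕ.≤-reflexive (cong toℕ (eq 0 (s≤s z≤n)))

≺-tail : ∀ {s t} → s 0 ≡ t 0 → s ≺ t → (s ∘ suc) ≺ (t ∘ suc)
≺-tail eq₀ (zero  , _  , lt) = contradiction lt (ℕ.<-irrefl (cong toℕ eq₀))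
≺-tail eq₀ (suc j , eq , lt) = j , (λ i i<j → eq (suc i) (s≤s i<j)) , lt

-- With a common period `n`, any difference shows among the first `n` letters, so a bounded search
-- settles the comparison.
≺-compare : ∀ {n s t} .{{_ : NonZero n}} → Period s n → Period t n → s ≺ t ⊎ t ≺ s ⊎ (∀ k → s k ≡ t k)
≺-compare {n} {s} {t} ps pt with search (λ k → ¬? (s k Fin.≟ t k)) n
... | inj₂ none = inj₂ (inj₂ λ k → trans (sym (Period-% ps k))
        (trans (decidable-stable (s (k % n) Fin.≟ t (k % n)) (none (k % n) (m%n<n k n))) (Period-% pt k)))
... | inj₁ (j , _ , s≢t , least) with ℕ.<-cmp (toℕ (s j)) (toℕ (t j))
...   | tri< lt _ _ = inj₁ (j , (λ i i<j → decidable-stable (s i Fin.≟ t i) (least i i<j)) , lt)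
...   | tri≈ _ eq _ = contradiction (Fin.toℕ-injective eq) s≢t
...   | tri> _ _ gt = inj₂ (inj₁ (j , (λ i i<j → sym (decidable-stable (s i Fin.≟ t i) (least i i<j))) , gt))

-- Finite orders

injective⇒surjective : ∀ {n} (f : Fin n → Fin n) → Injective _≡_ _≡_ f → ∀ y → ∃[ x ] f x ≡ y
injective⇒surjective {suc n} f inj y with Fin.any? (λ x → f x Fin.≟ y)
... | yes r = r
... | no ¬r = contradiction
  (Fin.injective⇒≤ {f = λ x → punchOut (missed x)} (λ {a} {b} → inj ∘ Fin.punchOut-injective (missed a) (missed b))) ℕ.1+n≰n
  where
  missed : ∀ x → y ≢ f x
  missed x eq = ¬r (x , sym eq)

strictMono⇒inflationary : ∀ {n} (g : Fin n → Fin n) → (∀ i j → toℕ i < toℕ j → toℕ (g i) < toℕ (g j)) →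
                          ∀ i → toℕ i ≤ toℕ (g i)
strictMono⇒inflationary g mono i = go (toℕ i) i refl
  where
  go : ∀ k i → toℕ i ≡ k → k ≤ toℕ (g i)
  go zero    i eq = z≤n
  go (suc k) i eq = ℕ.≤-trans (s≤s (go k j j≡k)) (mono j i (ℕ.≤-reflexive (trans (cong suc j≡k) (sym eq))))
    where
    k<n = ℕ.<-trans (ℕ.≤-reflexive (sym eq)) (Fin.toℕ<n i)
    j = fromℕ< k<n
    j≡k = Fin.toℕ-fromℕ< k<n

-- Sending each entry of `π` to the entry of `π′` at the same position is a strictly increasing map
-- on `Fin n`, hence nowhere below the identity. Used in both directions, this makes patterns
-- unique.
IsPerm-order-≤ : ∀ {n} (π π′ : Vec (Fin n) n) → IsPerm π →
  (∀ i j → lookup π i Fin.< lookup π j → lookup π′ i Fin.< lookup π′ j) → ∀ i → lookup π i Fin.≤ lookup π′ i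
IsPerm-order-≤ π π′ perm ord i =
  subst (λ x → toℕ (lookup π i) ≤ toℕ (lookup π′ x)) (perm _ _ (proj₂ (inv (lookup π i))))
    (strictMono⇒inflationary (λ y → lookup π′ (proj₁ (inv y)))
      (λ y z y<z → ord _ _ (subst₂ (λ a b → toℕ a < toℕ b) (sym (proj₂ (inv y))) (sym (proj₂ (inv z))) y<z))
      (lookup π i))
  where inv = injective⇒surjective (lookup π) (perm _ _)

module _ {n : ℕ} {R : Fin n → Fin n → Set} (R? : ∀ i j → Dec (R i j)) where

  below : Fin n → Subset n
  below i = tabulate (λ k → does (R? k i))

  ∈-below : ∀ {k i} → k Subset.∈ below i ⇔ R k i
  ∈-below {k} {i} = mk⇔
    (λ k∈ → witness (R? k i) (trans (sym (Vec.lookup∘tabulate _ k)) (Vec.[]=⇒lookup k∈)))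
    (λ r → Vec.lookup⇒[]= k _ (trans (Vec.lookup∘tabulate _ k) (dec-true (R? k i) r)))
    where
    witness : ∀ {P : Set} (P? : Dec P) → does P? ≡ true → P
    witness (yes p) _ = p

  module _ (irrefl : ∀ i → ¬ R i i) (trans′ : ∀ {i j k} → R i j → R j k → R i k) where

    below<n : ∀ i → ∣ below i ∣ < n
    below<n i = subst (∣ below i ∣ <_) (Subset.∣⊤∣≡n n)
      (Subset.p⊂q⇒∣p∣<∣q∣ ((λ _ → Subset.∈⊤) , i , Subset.∈⊤ , irrefl i ∘ to ∈-below))

    -- The number of elements below `i`; as `i` is not below itself, this number is less than `n`.
    -- Applied to the shifts of a word, it gives the pattern.
    rank : Fin n → Fin n
    rank i = fromℕ< (below<n i)

    rank-mono : ∀ {i j} → R i j → rank i Fin.< rank j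
    rank-mono {i} {j} r = subst₂ _<_ (sym (Fin.toℕ-fromℕ< (below<n i))) (sym (Fin.toℕ-fromℕ< (below<n j)))
      (Subset.p⊂q⇒∣p∣<∣q∣ ((λ k∈ → from ∈-below (trans′ (to ∈-below k∈) r)) ,
                            i , from ∈-below r , irrefl i ∘ to ∈-below))

-- Descents

letter-< : ∀ {a b : Letter} → a Fin.≤ b → a ≢ b → a ≡ Fin.zero × b ≡ Fin.suc Fin.zero
letter-< {Fin.zero}          {Fin.zero}          _ a≢b = contradiction refl a≢b
letter-< {Fin.zero}          {Fin.suc Fin.zero}  _ _   = refl , refl
letter-< {Fin.suc Fin.zero}  {Fin.suc Fin.zero}  _ a≢b = contradiction refl a≢b

letter-≤0 : ∀ {a : Letter} → a Fin.≤ Fin.zero {1} → a ≡ Fin.zero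
letter-≤0 {Fin.zero} _ = refl

letter-≥1 : ∀ {a : Letter} → Fin.suc {1} Fin.zero Fin.≤ a → a ≡ Fin.suc Fin.zero
letter-≥1 {Fin.suc Fin.zero} _ = refl

-- Encodes a cut of v into two weakly increasing blocks: label 0 before it, 1 after it.
Labelling : ∀ {m n} → Vec (Fin m) n → (Fin n → Letter) → Set
Labelling v ℓ = (∀ i j → i Fin.≤ j → ℓ i Fin.≤ ℓ j) ×
                (∀ i j → i Fin.≤ j → ℓ i ≡ ℓ j → lookup v i Fin.≤ lookup v j)

module _ {m : ℕ} where

  desList-descent : ∀ {x y : Fin m} xs → y Fin.< x → desList (x List.∷ y List.∷ xs) ≡ suc (desList (y List.∷ xs))
  desList-descent {x} {y} xs y<x = cong (_+ desList (y List.∷ xs)) (if-yes (y Fin.<? x) y<x)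

  desList-ascent : ∀ {x y : Fin m} xs → ¬ y Fin.< x → desList (x List.∷ y List.∷ xs) ≡ desList (y List.∷ xs)
  desList-ascent {x} {y} xs y≮x = cong (_+ desList (y List.∷ xs)) (if-no (y Fin.<? x) y≮x)

  des≡0⇒mono : ∀ {n} (v : Vec (Fin m) n) → desList (toList v) ≡ 0 →
               ∀ i j → i Fin.≤ j → lookup v i Fin.≤ lookup v j
  des≡0⇒mono (x ∷ [])    d Fin.zero Fin.zero _ = ℕ.≤-refl
  des≡0⇒mono (x ∷ y ∷ v) d i j i≤j with y Fin.<? x
  des≡0⇒mono (x ∷ y ∷ v) d i j i≤j | yes y<x = contradiction (trans (sym (desList-descent (toList v) y<x)) d) λ ()
  des≡0⇒mono (x ∷ y ∷ v) d Fin.zero    Fin.zero    _         | no _   = ℕ.≤-refl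
  des≡0⇒mono (x ∷ y ∷ v) d Fin.zero    (Fin.suc j) _         | no y≮x =
    ℕ.≤-trans (ℕ.≮⇒≥ y≮x) (des≡0⇒mono (y ∷ v) (trans (sym (desList-ascent (toList v) y≮x)) d) Fin.zero j z≤n)
  des≡0⇒mono (x ∷ y ∷ v) d (Fin.suc i) (Fin.suc j) (s≤s i≤j) | no y≮x =
    des≡0⇒mono (y ∷ v) (trans (sym (desList-ascent (toList v) y≮x)) d) i j i≤j

  mono⇒des≡0 : ∀ {n} (v : Vec (Fin m) n) → (∀ i j → i Fin.≤ j → lookup v i Fin.≤ lookup v j) →
               desList (toList v) ≡ 0
  mono⇒des≡0 []          mono = refl
  mono⇒des≡0 (x ∷ [])    mono = refl
  mono⇒des≡0 (x ∷ y ∷ v) mono with y Fin.<? x | mono⇒des≡0 (y ∷ v)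
  ... | yes y<x | _  = contradiction (mono Fin.zero (Fin.suc Fin.zero) z≤n) (ℕ.<⇒≱ y<x)
  ... | no y≮x  | ih = trans (desList-ascent (toList v) y≮x)
        (ih λ i j i≤j → mono (Fin.suc i) (Fin.suc j) (s≤s i≤j))

  -- The label changes exactly at the descent: an entry followed by the descent starts the second
  -- block, while a head without descent inherits the label of its successor.
  des≡1⇒labelling : ∀ {n} (v : Vec (Fin m) n) → desList (toList v) ≡ 1 → ∃[ ℓ ] Labelling v ℓ
  des≡1⇒labelling (x ∷ y ∷ v) d with y Fin.<? x | des≡1⇒labelling (y ∷ v)
  ... | yes y<x | _ = ℓ , mono , incr
    where
    ℓ : Fin _ → Letter
    ℓ Fin.zero    = Fin.zero
    ℓ (Fin.suc _) = Fin.suc Fin.zero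
    mono : ∀ i j → i Fin.≤ j → ℓ i Fin.≤ ℓ j
    mono Fin.zero    j           _ = z≤n
    mono (Fin.suc i) (Fin.suc j) _ = ℕ.≤-refl
    incr : ∀ i j → i Fin.≤ j → ℓ i ≡ ℓ j → lookup (x ∷ y ∷ v) i Fin.≤ lookup (x ∷ y ∷ v) j
    incr Fin.zero    Fin.zero    _         _ = ℕ.≤-refl
    incr (Fin.suc i) (Fin.suc j) (s≤s i≤j) _ =
      des≡0⇒mono (y ∷ v) (ℕ.suc-injective (trans (sym (desList-descent (toList v) y<x)) d)) i j i≤j
  ... | no y≮x | ih with ih (trans (sym (desList-ascent (toList v) y≮x)) d)
  ...   | ℓ′ , mono′ , incr′ = ℓ , mono , incr
    where
    ℓ : Fin _ → Letter
    ℓ Fin.zero    = ℓ′ Fin.zero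
    ℓ (Fin.suc i) = ℓ′ i
    mono : ∀ i j → i Fin.≤ j → ℓ i Fin.≤ ℓ j
    mono Fin.zero    Fin.zero    _         = ℕ.≤-refl
    mono Fin.zero    (Fin.suc j) _         = mono′ Fin.zero j z≤n
    mono (Fin.suc i) (Fin.suc j) (s≤s i≤j) = mono′ i j i≤j
    incr : ∀ i j → i Fin.≤ j → ℓ i ≡ ℓ j → lookup (x ∷ y ∷ v) i Fin.≤ lookup (x ∷ y ∷ v) j
    incr Fin.zero    Fin.zero    _         _  = ℕ.≤-refl
    incr Fin.zero    (Fin.suc j) _         eq = ℕ.≤-trans (ℕ.≮⇒≥ y≮x) (incr′ Fin.zero j z≤n eq)
    incr (Fin.suc i) (Fin.suc j) (s≤s i≤j) eq = incr′ i j i≤j eq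

  labelling-descent : ∀ {n} (v : Vec (Fin m) n) {ℓ} → Labelling v ℓ → ∀ i j → i Fin.≤ j →
                      lookup v j Fin.< lookup v i → ℓ i ≡ Fin.zero × ℓ j ≡ Fin.suc Fin.zero
  labelling-descent v (mono , incr) i j i≤j desc =
    letter-< (mono i j i≤j) λ eq → ℕ.<⇒≱ desc (incr i j i≤j eq)

  -- A descent must cross from label 0 to label 1; from there on all labels are 1, so the remaining
  -- entries increase.
  labelling⇒des≤1 : ∀ {n} (v : Vec (Fin m) n) {ℓ} → Labelling v ℓ → desList (toList v) ≤ 1
  labelling⇒des≤1 []              _   = z≤n
  labelling⇒des≤1 (x ∷ [])        _   = z≤n
  labelling⇒des≤1 (x ∷ y ∷ v) {ℓ} lab@(mono , incr) with y Fin.<? x | labelling⇒des≤1 (y ∷ v)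
  ... | no y≮x  | ih = subst (_≤ 1) (sym (desList-ascent (toList v) y≮x)) (ih {ℓ ∘ Fin.suc}
        ((λ i j i≤j → mono (Fin.suc i) (Fin.suc j) (s≤s i≤j)) , (λ i j i≤j → incr (Fin.suc i) (Fin.suc j) (s≤s i≤j))))
  ... | yes y<x | _ = ℕ.≤-reflexive (trans (desList-descent (toList v) y<x) (cong suc (mono⇒des≡0 (y ∷ v) λ i j i≤j →
        incr (Fin.suc i) (Fin.suc j) (s≤s i≤j) (trans (ℓ≡1 i) (sym (ℓ≡1 j))))))
    where
    ℓ≡1 : ∀ i → ℓ (Fin.suc i) ≡ Fin.suc Fin.zero
    ℓ≡1 i = letter-≥1 (subst (Fin._≤ ℓ (Fin.suc i))
      (proj₂ (labelling-descent (x ∷ y ∷ v) {ℓ} lab Fin.zero (Fin.suc Fin.zero) z≤n y<x))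
      (mono (Fin.suc Fin.zero) (Fin.suc i) (s≤s z≤n)))

  descent : ∀ {n} (v : Vec (Fin m) n) → desList (toList v) ≢ 0 →
            ∃[ i ] ∃[ j ] (toℕ j ≡ suc (toℕ i) × lookup v j Fin.< lookup v i)
  descent []          d = contradiction refl d
  descent (x ∷ [])    d = contradiction refl d
  descent (x ∷ y ∷ v) d with y Fin.<? x | descent (y ∷ v)
  ... | yes y<x | _  = Fin.zero , Fin.suc Fin.zero , refl , y<x
  ... | no y≮x  | ih = let i , j , eq , lt = ih (d ∘ trans (desList-ascent (toList v) y≮x)) in
        Fin.suc i , Fin.suc j , cong suc eq , lt

  -- A descent at adjacent positions `i` and `j` forces label 0 at `i` and 1 at `j`, and
  -- monotonicity then fixes every other label. With no descent the cut could lie anywhere.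
  labelling-unique : ∀ {n} (v : Vec (Fin m) n) → desList (toList v) ≢ 0 → ∀ {ℓ ℓ′} →
                     Labelling v ℓ → Labelling v ℓ′ → ∀ z → ℓ z ≡ ℓ′ z
  labelling-unique v d lab lab′ z = trans (value lab) (sym (value lab′))
    where
    i = proj₁ (descent v d)
    j = proj₁ (proj₂ (descent v d))
    j≡1+i = proj₁ (proj₂ (proj₂ (descent v d)))
    desc = proj₂ (proj₂ (proj₂ (descent v d)))
    value : ∀ {ℓ} → Labelling v ℓ → ℓ z ≡ (if does (toℕ z ≤? toℕ i) then Fin.zero else Fin.suc Fin.zero)
    value {ℓ} lab@(mono , _)
      with toℕ z ≤? toℕ i | labelling-descent v {ℓ} lab i j (ℕ.≤-trans (ℕ.n≤1+n _) (ℕ.≤-reflexive (sym j≡1+i))) desc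
    ... | yes z≤i | ℓi≡0 , _ = trans (letter-≤0 (subst (ℓ z Fin.≤_) ℓi≡0 (mono z i z≤i))) (sym (if-yes (toℕ z ≤? toℕ i) z≤i))
    ... | no z≰i  | _ , ℓj≡1 = trans (letter-≥1 (subst (Fin._≤ ℓ z) ℓj≡1 (mono j z (subst (_≤ toℕ z) (sym j≡1+i) (ℕ.≰⇒> z≰i)))))
                                     (sym (if-no (toℕ z ≤? toℕ i) z≰i))

-- Cycles

iter-+ : ∀ {n} (τ : Vec (Fin n) n) a b x → iter τ (a + b) x ≡ iter τ a (iter τ b x)
iter-+ τ zero    b x = refl
iter-+ τ (suc a) b x = cong (lookup τ) (iter-+ τ a b x)

iter-injective : ∀ {n} {τ : Vec (Fin n) n} → IsPerm τ → ∀ k {x y} → iter τ k x ≡ iter τ k y → x ≡ y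
iter-injective perm zero    eq = eq
iter-injective perm (suc k) eq = iter-injective perm k (perm _ _ eq)

iter-* : ∀ {n} (τ : Vec (Fin n) n) {p x} → iter τ p x ≡ x → ∀ a k → iter τ (a + k * p) x ≡ iter τ a x
iter-* τ {p} {x} ret a zero    = cong (λ k → iter τ k x) (ℕ.+-identityʳ a)
iter-* τ {p} {x} ret a (suc k) = begin
  iter τ (a + (p + k * p)) x      ≡⟨ cong (λ b → iter τ b x) (trans (cong (_+_ a) (ℕ.+-comm p _)) (sym (ℕ.+-assoc a (k * p) p))) ⟩
  iter τ (a + k * p + p) x        ≡⟨ iter-+ τ (a + k * p) p x ⟩
  iter τ (a + k * p) (iter τ p x) ≡⟨ cong (iter τ (a + k * p)) ret ⟩
  iter τ (a + k * p) x            ≡⟨ iter-* τ ret a k ⟩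
  iter τ a x                      ∎
  where open ≡-Reasoning

iter-% : ∀ {n} (τ : Vec (Fin n) n) {p x} .{{_ : NonZero p}} → iter τ p x ≡ x → ∀ k → iter τ (k % p) x ≡ iter τ k x
iter-% τ {p} {x} ret k = trans (sym (iter-* τ ret (k % p) (k / p))) (cong (λ b → iter τ b x) (sym (m≡m%n+[m/n]*n k p)))

-- If `x` returns after `p` steps, its orbit has at most `p` points; but the orbit of a cycle
-- contains all `n`.
return⇒≥ : ∀ {n} {τ : Vec (Fin n) n} → IsNCycle τ → ∀ {p x} .{{_ : NonZero p}} → iter τ p x ≡ x → n ≤ p
return⇒≥ {τ = τ} cyc {p} {x} ret = Fin.injective⇒≤ {f = λ y → proj₁ (cyc x y) mod p} λ {y} {z} eq →
  trans (sym (recover y)) (trans (cong (λ i → iter τ (toℕ i) x) eq) (recover z))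
  where
  recover : ∀ y → iter τ (toℕ (proj₁ (cyc x y) mod p)) x ≡ y
  recover y = trans (cong (λ k → iter τ k x) (toℕ-mod (proj₁ (cyc x y)) p))
    (trans (iter-% τ ret (proj₁ (cyc x y))) (proj₂ (cyc x y)))

iter-return : ∀ {n} {τ : Vec (Fin n) n} → IsPerm τ → ∀ x {a b} → a ≤ b → iter τ a x ≡ iter τ b x → iter τ (b ∸ a) x ≡ x
iter-return {τ = τ} perm x {a} {b} a≤b eq = iter-injective perm a
  (trans (sym (iter-+ τ a (b ∸ a) x)) (trans (cong (λ k → iter τ k x) (ℕ.m+[n∸m]≡n a≤b)) (sym eq)))

-- Two of the iterates with exponents 0 to `n` coincide, so some positive return time is at most
-- `n`; by `return⇒≥` it is also at least `n`.
iter-n : ∀ {n} {τ : Vec (Fin n) n} → IsPerm τ → IsNCycle τ → ∀ x → iter τ n x ≡ x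
iter-n {n} {τ} perm cyc x with Fin.pigeonhole (ℕ.n<1+n n) (λ i → iter τ (toℕ i) x)
... | i , j , i<j , eq = subst (λ p → iter τ p x ≡ x)
  (ℕ.≤-antisym (ℕ.≤-trans (ℕ.m∸n≤m (toℕ j) (toℕ i)) (ℕ.≤-pred (Fin.toℕ<n j)))
    (return⇒≥ cyc {{ℕ.>-nonZero (ℕ.m<n⇒0<n∸m i<j)}} ret)) ret
  where
  ret = iter-return perm x (ℕ.<⇒≤ i<j) eq

-- Passing between one-line notation and cycle notation

module _ {n : ℕ} where

  private N = suc n

  at : ∀ {A : Set} → Vec A N → ℕ → A
  at π k = lookup π (k mod N)

  at-cong : ∀ {A : Set} (π : Vec A N) a b → a % N ≡ b % N → at π a ≡ at π b
  at-cong π a b eq = cong (lookup π) (mod-cong a b N eq)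

  at-toℕ : ∀ {A : Set} (π : Vec A N) i → at π (toℕ i) ≡ lookup π i
  at-toℕ π i = cong (lookup π) (mod-toℕ i)

  orbit : Vec (Fin N) N → Fin N → Vec (Fin N) N
  orbit τ x = tabulate (λ i → iter τ (toℕ i) x)

  lookup-orbit : ∀ τ x i → lookup (orbit τ x) i ≡ iter τ (toℕ i) x
  lookup-orbit τ x = Vec.lookup∘tabulate (λ i → iter τ (toℕ i) x)

  module _ (τ : Vec (Fin N) N) (perm : IsPerm τ) (cyc : IsNCycle τ) (x : Fin N) where

    at-orbit : ∀ k → at (orbit τ x) k ≡ iter τ k x
    at-orbit k = trans (lookup-orbit τ x (k mod N))
      (trans (cong (λ k → iter τ k x) (toℕ-mod k N)) (iter-% τ (iter-n perm cyc x) k))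

    iter-distinct : ∀ {a b} → a < b → b < N → iter τ a x ≢ iter τ b x
    iter-distinct {a} {b} a<b b<N eq = ℕ.<⇒≱ b<N (ℕ.≤-trans
      (return⇒≥ cyc {{ℕ.>-nonZero (ℕ.m<n⇒0<n∸m a<b)}} (iter-return perm x (ℕ.<⇒≤ a<b) eq)) (ℕ.m∸n≤m b a))

    orbit-IsPerm : IsPerm (orbit τ x)
    orbit-IsPerm i j eq with ℕ.<-cmp (toℕ i) (toℕ j)
      | trans (sym (lookup-orbit τ x i)) (trans eq (lookup-orbit τ x j))
    ... | tri< i<j _ _ | eq′ = contradiction eq′ (iter-distinct i<j (Fin.toℕ<n j))
    ... | tri≈ _ i≡j _ | _   = Fin.toℕ-injective i≡j
    ... | tri> _ _ j<i | eq′ = contradiction (sym eq′) (iter-distinct j<i (Fin.toℕ<n i))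

  -- junk value zero when y is not an entry of π
  preimage : Vec (Fin N) N → Fin N → Fin N
  preimage π y with Fin.any? (λ i → lookup π i Fin.≟ y)
  ... | yes (i , _) = i
  ... | no _        = Fin.zero

  lookup-preimage : ∀ π → IsPerm π → ∀ y → lookup π (preimage π y) ≡ y
  lookup-preimage π perm y with Fin.any? (λ i → lookup π i Fin.≟ y)
  ... | yes (i , eq) = eq
  ... | no ¬r        = contradiction (injective⇒surjective (lookup π) (perm _ _) y) ¬r

  preimage-lookup : ∀ π → IsPerm π → ∀ i → preimage π (lookup π i) ≡ i
  preimage-lookup π perm i = perm _ _ (lookup-preimage π perm (lookup π i))

  cycleOf : Vec (Fin N) N → Vec (Fin N) N
  cycleOf π = tabulate (λ y → at π (suc (toℕ (preimage π y))))

  lookup-cycleOf-preimage : ∀ π y → lookup (cycleOf π) y ≡ at π (suc (toℕ (preimage π y)))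
  lookup-cycleOf-preimage π = Vec.lookup∘tabulate (λ y → at π (suc (toℕ (preimage π y))))

  cycleOf-orbit : ∀ τ → IsPerm τ → IsNCycle τ → ∀ x → cycleOf (orbit τ x) ≡ τ
  cycleOf-orbit τ perm cyc x = lookup-ext λ y → let i = preimage (orbit τ x) y in begin
    lookup (cycleOf (orbit τ x)) y  ≡⟨ lookup-cycleOf-preimage (orbit τ x) y ⟩
    at (orbit τ x) (suc (toℕ i))    ≡⟨ at-orbit τ perm cyc x (suc (toℕ i)) ⟩
    lookup τ (iter τ (toℕ i) x)     ≡⟨ cong (lookup τ) (lookup-orbit τ x i) ⟨
    lookup τ (lookup (orbit τ x) i) ≡⟨ cong (lookup τ) (lookup-preimage (orbit τ x) (orbit-IsPerm τ perm cyc x) y) ⟩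
    lookup τ y                      ∎
    where open ≡-Reasoning

  module _ (π : Vec (Fin N) N) (perm : IsPerm π) where

    lookup-cycleOf : ∀ k → lookup (cycleOf π) (at π k) ≡ at π (suc k)
    lookup-cycleOf k = trans (lookup-cycleOf-preimage π (at π k))
      (at-cong π (suc (toℕ (preimage π (at π k)))) (suc k) (begin
        suc (toℕ (preimage π (at π k))) % N  ≡⟨ cong (λ i → suc (toℕ i) % N) (preimage-lookup π perm (k mod N)) ⟩
        suc (toℕ (k mod N)) % N              ≡⟨ cong (λ i → suc i % N) (toℕ-mod k N) ⟩
        suc (k % N) % N                      ≡⟨ cong (_% N) (ℕ.+-comm 1 (k % N)) ⟩
        (k % N + 1) % N                      ≡⟨ %-+ˡ k 1 N ⟩
        (k + 1) % N                          ≡⟨ cong (_% N) (ℕ.+-comm k 1) ⟩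
        suc k % N                            ∎))
      where open ≡-Reasoning

    iter-cycleOf : ∀ k a → iter (cycleOf π) k (at π a) ≡ at π (k + a)
    iter-cycleOf zero    a = refl
    iter-cycleOf (suc k) a = trans (cong (lookup (cycleOf π)) (iter-cycleOf k a)) (lookup-cycleOf (k + a))

    at-preimage : ∀ y → at π (toℕ (preimage π y)) ≡ y
    at-preimage y = trans (at-toℕ π (preimage π y)) (lookup-preimage π perm y)

    cycleOf-IsNCycle : IsNCycle (cycleOf π)
    -- Modulo `N = suc n` the number `i * n` is minus `i`, so this many steps lead from position `i`
    -- to position `j` without truncated subtraction.
    cycleOf-IsNCycle x y = j + i * n , (begin
      iter (cycleOf π) (j + i * n) x         ≡⟨ cong (iter (cycleOf π) (j + i * n)) (at-preimage x) ⟨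
      iter (cycleOf π) (j + i * n) (at π i)  ≡⟨ iter-cycleOf (j + i * n) i ⟩
      at π (j + i * n + i)                   ≡⟨ cong (at π) (trans (ℕ.+-assoc j (i * n) i)
                                                  (cong (_+_ j) (trans (ℕ.+-comm (i * n) i) (sym (ℕ.*-suc i n))))) ⟩
      at π (j + i * N)                       ≡⟨ at-cong π (j + i * N) j ([m+kn]%n≡m%n j i N) ⟩
      at π j                                 ≡⟨ at-preimage y ⟩
      y                                      ∎)
      where
      open ≡-Reasoning
      i = toℕ (preimage π x)
      j = toℕ (preimage π y)

    orbit-cycleOf : orbit (cycleOf π) (lookup π Fin.zero) ≡ π
    orbit-cycleOf = lookup-ext λ i → trans (lookup-orbit (cycleOf π) (lookup π Fin.zero) i)
      (trans (iter-cycleOf (toℕ i) 0) (trans (cong (at π) (ℕ.+-identityʳ (toℕ i))) (at-toℕ π i)))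

    -- After one step, `n` more complete a full turn of `N`; so the `n`-th iterate is a left
    -- inverse.
    cycleOf-IsPerm : IsPerm (cycleOf π)
    cycleOf-IsPerm x y eq = begin
      x                                        ≡⟨ back x ⟨
      iter (cycleOf π) n (lookup (cycleOf π) x) ≡⟨ cong (iter (cycleOf π) n) eq ⟩
      iter (cycleOf π) n (lookup (cycleOf π) y) ≡⟨ back y ⟩
      y                                        ∎
      where
      open ≡-Reasoning
      back : ∀ x → iter (cycleOf π) n (lookup (cycleOf π) x) ≡ x
      back x = begin
        iter (cycleOf π) n (lookup (cycleOf π) x)        ≡⟨ cong (iter (cycleOf π) n ∘ lookup (cycleOf π)) (at-preimage x) ⟨
        iter (cycleOf π) n (lookup (cycleOf π) (at π i)) ≡⟨ cong (iter (cycleOf π) n) (lookup-cycleOf i) ⟩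
        iter (cycleOf π) n (at π (suc i))                ≡⟨ iter-cycleOf n (suc i) ⟩
        at π (n + suc i)                                 ≡⟨ cong (at π) (trans (ℕ.+-suc n i) (ℕ.+-comm N i)) ⟩
        at π (i + N)                                     ≡⟨ at-cong π (i + N) i ([m+n]%n≡m%n i N) ⟩
        at π i                                           ≡⟨ at-preimage x ⟩
        x                                                ∎
        where i = toℕ (preimage π x)

  -- Without descents `τ` is monotone, so every later iterate of 0 is at least its first image. That
  -- image is positive, as 0 is not fixed, and so 0 is never reached again.
  des-cycle≢0 : 2 ≤ N → ∀ {τ : Vec (Fin N) N} → IsPerm τ → IsNCycle τ → des τ ≢ 0
  des-cycle≢0 2≤N {τ} perm cyc d≡0 =
    ℕ.<-irrefl (sym (cong toℕ (iter-n perm cyc Fin.zero))) (positive n)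
    where
    τ0≢0 : lookup τ Fin.zero ≢ Fin.zero
    τ0≢0 eq = ℕ.<⇒≱ 2≤N (return⇒≥ cyc {1} eq)
    positive : ∀ k → 0 < toℕ (iter τ (suc k) Fin.zero)
    positive zero    = ℕ.n≢0⇒n>0 (τ0≢0 ∘ Fin.toℕ-injective)
    positive (suc k) = ℕ.<-≤-trans (positive zero) (des≡0⇒mono τ d≡0 Fin.zero (iter τ (suc k) Fin.zero) z≤n)

  -- Patterns of words

  shiftAt-Period : ∀ (w : Vec Letter N) a → Period (shiftAt w a) N
  shiftAt-Period w a i = trans (cong (periodic w) (sym (ℕ.+-assoc a i N))) (periodic-Period w (a + i))

  shiftAt-compare : ∀ (w : Vec Letter N) a b →
    shiftAt w a ≺ shiftAt w b ⊎ shiftAt w b ≺ shiftAt w a ⊎ (∀ k → shiftAt w a k ≡ shiftAt w b k)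
  shiftAt-compare w a b = ≺-compare (shiftAt-Period w a) (shiftAt-Period w b)

  shiftAt-≺? : ∀ (w : Vec Letter N) a b → Dec (shiftAt w a ≺ shiftAt w b)
  shiftAt-≺? w a b with shiftAt-compare w a b
  ... | inj₁ a≺b        = yes a≺b
  ... | inj₂ (inj₁ b≺a) = no (≺-asym b≺a)
  ... | inj₂ (inj₂ eq)  = no (≺-irrefl eq)

  shiftAt-mod : ∀ (w : Vec Letter N) a k → shiftAt w (toℕ (a mod N)) k ≡ shiftAt w a k
  shiftAt-mod w a k = trans (cong (λ x → periodic w (x + k)) (toℕ-mod a N))
    (periodic-cong w (a % N + k) (a + k) (%-+ˡ a k N))

  -- Equal shifts give the period `b ∸ a` from index `a` onwards. Adding `a * N` to an index first
  -- carries it beyond `a`, which extends the period to the whole word.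
  shiftAt-distinct : ∀ (w : Vec Letter N) → Aperiodic w → ∀ {a b} → a < b → b < N →
                     ¬ (∀ k → shiftAt w a k ≡ shiftAt w b k)
  shiftAt-distinct w ap {a} {b} a<b b<N eq = ap (b ∸ a) (ℕ.m<n⇒0<n∸m a<b) (ℕ.≤-<-trans (ℕ.m∸n≤m b a) b<N) λ i → begin
    periodic w (i + (b ∸ a))             ≡⟨ Period-* (periodic-Period w) a (i + (b ∸ a)) ⟨
    periodic w (i + (b ∸ a) + a * N)     ≡⟨ cong (periodic w) (rearrange i) ⟩
    periodic w (b + (i + a * n))         ≡⟨ eq (i + a * n) ⟨
    periodic w (a + (i + a * n))         ≡⟨ cong (periodic w) (rearrange′ i) ⟩
    periodic w (i + a * N)               ≡⟨ Period-* (periodic-Period w) a i ⟩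
    periodic w i                         ∎
    where
    open ≡-Reasoning
    rearrange′ : ∀ i → a + (i + a * n) ≡ i + a * N
    rearrange′ i = begin
      a + (i + a * n)  ≡⟨ ℕ.+-assoc a i (a * n) ⟨
      a + i + a * n    ≡⟨ cong (_+ a * n) (ℕ.+-comm a i) ⟩
      i + a + a * n    ≡⟨ ℕ.+-assoc i a (a * n) ⟩
      i + (a + a * n)  ≡⟨ cong (_+_ i) (ℕ.*-suc a n) ⟨
      i + a * N        ∎
    rearrange : ∀ i → i + (b ∸ a) + a * N ≡ b + (i + a * n)
    rearrange i = begin
      i + (b ∸ a) + a * N        ≡⟨ cong (_+ a * N) (ℕ.+-comm i (b ∸ a)) ⟩
      b ∸ a + i + a * N          ≡⟨ ℕ.+-assoc (b ∸ a) i (a * N) ⟩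
      b ∸ a + (i + a * N)        ≡⟨ cong (_+_ (b ∸ a)) (rearrange′ i) ⟨
      b ∸ a + (a + (i + a * n))  ≡⟨ ℕ.+-assoc (b ∸ a) a (i + a * n) ⟨
      b ∸ a + a + (i + a * n)    ≡⟨ cong (_+ (i + a * n)) (ℕ.m∸n+n≡m (ℕ.<⇒≤ a<b)) ⟩
      b + (i + a * n)            ∎

  shiftAt-injective : ∀ (w : Vec Letter N) → Aperiodic w → ∀ (i j : Fin N) →
                      (∀ k → shiftAt w (toℕ i) k ≡ shiftAt w (toℕ j) k) → i ≡ j
  shiftAt-injective w ap i j eq with ℕ.<-cmp (toℕ i) (toℕ j)
  ... | tri< i<j _ _ = contradiction eq (shiftAt-distinct w ap i<j (Fin.toℕ<n j))
  ... | tri≈ _ i≡j _ = Fin.toℕ-injective i≡j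
  ... | tri> _ _ j<i = contradiction (sym ∘ eq) (shiftAt-distinct w ap j<i (Fin.toℕ<n i))

  rankAt : Vec Letter N → Fin N → Fin N
  rankAt w = rank {R = λ i j → shiftAt w (toℕ i) ≺ shiftAt w (toℕ j)} (λ i j → shiftAt-≺? w (toℕ i) (toℕ j))
    (λ i → ≺-irrefl (λ _ → refl)) ≺-trans

  patternOf : Vec Letter N → Vec (Fin N) N
  patternOf w = tabulate (rankAt w)

  rankAt-mono : ∀ (w : Vec Letter N) {i j} → shiftAt w (toℕ i) ≺ shiftAt w (toℕ j) → rankAt w i Fin.< rankAt w j
  rankAt-mono w = rank-mono {R = λ i j → shiftAt w (toℕ i) ≺ shiftAt w (toℕ j)} (λ i j → shiftAt-≺? w (toℕ i) (toℕ j))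
    (λ i → ≺-irrefl (λ _ → refl)) ≺-trans

  -- The shifts of an aperiodic word are totally ordered, so an order-preserving map on them is
  -- injective and reflects the order.
  preserving⇒IsPattern : ∀ (w : Vec Letter N) → Aperiodic w → ∀ π →
    (∀ i j → shiftAt w (toℕ i) ≺ shiftAt w (toℕ j) → lookup π i Fin.< lookup π j) → IsPattern w π
  preserving⇒IsPattern w ap π preserves = perm , λ i j → mk⇔ (reflects i j) (preserves i j)
    where
    perm : IsPerm π
    perm i j eq with shiftAt-compare w (toℕ i) (toℕ j)
    ... | inj₁ i≺j        = contradiction (preserves i j i≺j) (ℕ.<-irrefl (cong toℕ eq))
    ... | inj₂ (inj₁ j≺i) = contradiction (preserves j i j≺i) (ℕ.<-irrefl (cong toℕ (sym eq)))
    ... | inj₂ (inj₂ eq′) = shiftAt-injective w ap i j eq′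
    reflects : ∀ i j → lookup π i Fin.< lookup π j → shiftAt w (toℕ i) ≺ shiftAt w (toℕ j)
    reflects i j lt with shiftAt-compare w (toℕ i) (toℕ j)
    ... | inj₁ i≺j        = i≺j
    ... | inj₂ (inj₁ j≺i) = contradiction (preserves j i j≺i) (ℕ.<-asym lt)
    ... | inj₂ (inj₂ eq)  = contradiction lt (ℕ.<-irrefl (cong (toℕ ∘ lookup π) (shiftAt-injective w ap i j eq)))

  patternOf-IsPattern : ∀ (w : Vec Letter N) → Aperiodic w → IsPattern w (patternOf w)
  patternOf-IsPattern w ap = preserving⇒IsPattern w ap (patternOf w) λ i j i≺j →
    subst₂ Fin._<_ (sym (Vec.lookup∘tabulate (rankAt w) i)) (sym (Vec.lookup∘tabulate (rankAt w) j)) (rankAt-mono w i≺j)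

  IsPattern-unique : ∀ (w : Vec Letter N) π π′ → IsPattern w π → IsPattern w π′ → π ≡ π′
  IsPattern-unique w π π′ (perm , ord) (perm′ , ord′) = lookup-ext λ i → Fin.toℕ-injective (ℕ.≤-antisym
    (IsPerm-order-≤ π π′ perm (λ i j → from (ord′ i j) ∘ to (ord i j)) i)
    (IsPerm-order-≤ π′ π perm′ (λ i j → from (ord i j) ∘ to (ord′ i j)) i))

  module _ (w : Vec Letter N) (π : Vec (Fin N) N) (isPattern : IsPattern w π) where

    private
      perm = proj₁ isPattern

      ι : Fin N → ℕ
      ι y = toℕ (preimage π y)

    -- Reading indices modulo `N` covers the step from the last position back to the first.
    at-< : ∀ a b → at π a Fin.< at π b ⇔ shiftAt w a ≺ shiftAt w b
    at-< a b = mk⇔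
      (≺-resp (shiftAt-mod w a) (shiftAt-mod w b) ∘ to (proj₂ isPattern (a mod N) (b mod N)))
      (from (proj₂ isPattern (a mod N) (b mod N)) ∘ ≺-resp (sym ∘ shiftAt-mod w a) (sym ∘ shiftAt-mod w b))

    -- Indexed by rank rather than by position: in the order of ranks the shifts starting with 0
    -- come first.
    firstLetter : Fin N → Letter
    firstLetter y = shiftAt w (ι y) 0

    firstLetter-labelling : Labelling (cycleOf π) firstLetter
    firstLetter-labelling = mono , incr
      where
      ≺-of-< : ∀ y z → y Fin.< z → shiftAt w (ι y) ≺ shiftAt w (ι z)
      ≺-of-< y z y<z = to (at-< (ι y) (ι z))
        (subst₂ Fin._<_ (sym (at-preimage π perm y)) (sym (at-preimage π perm z)) y<z)
      mono : ∀ y z → y Fin.≤ z → firstLetter y Fin.≤ firstLetter z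
      mono y z y≤z with ℕ.m≤n⇒m<n∨m≡n y≤z
      ... | inj₁ y<z = ≺-head (≺-of-< y z y<z)
      ... | inj₂ y≡z = ℕ.≤-reflexive (cong (toℕ ∘ firstLetter) (Fin.toℕ-injective y≡z))
      tail : ∀ a k → shiftAt w a (suc k) ≡ shiftAt w (suc a) k
      tail a k = cong (periodic w) (ℕ.+-suc a k)
      incr : ∀ y z → y Fin.≤ z → firstLetter y ≡ firstLetter z → lookup (cycleOf π) y Fin.≤ lookup (cycleOf π) z
      incr y z y≤z eq with ℕ.m≤n⇒m<n∨m≡n y≤z
      ... | inj₁ y<z = ℕ.<⇒≤ (subst₂ Fin._<_ (sym (lookup-cycleOf-preimage π y)) (sym (lookup-cycleOf-preimage π z))
              (from (at-< (suc (ι y)) (suc (ι z))) (≺-resp (tail (ι y)) (tail (ι z)) (≺-tail eq (≺-of-< y z y<z)))))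
      ... | inj₂ y≡z = ℕ.≤-reflexive (cong (toℕ ∘ lookup (cycleOf π)) (Fin.toℕ-injective y≡z))

    firstLetter-lookup : ∀ i → firstLetter (lookup π i) ≡ lookup w i
    firstLetter-lookup i = trans (cong (periodic w) (trans (ℕ.+-identityʳ _) (cong toℕ (preimage-lookup π perm i))))
      (periodic-toℕ w i)

    cycleOf-CycDes : 2 ≤ N → CycDes N 2 (cycleOf π)
    cycleOf-CycDes 2≤N = cycleOf-IsPerm π perm , cycleOf-IsNCycle π perm ,
      ℕ.≤-antisym (labelling⇒des≤1 (cycleOf π) {firstLetter} firstLetter-labelling)
        (ℕ.n≢0⇒n>0 (des-cycle≢0 2≤N (cycleOf-IsPerm π perm) (cycleOf-IsNCycle π perm)))

  -- The cycle depends on `π` alone, and the first letters of either word label it; having a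
  -- descent, it admits only one labelling.
  word-determined : 2 ≤ N → ∀ (w w′ : Vec Letter N) π → IsPattern w π → IsPattern w′ π → w ≡ w′
  word-determined 2≤N w w′ π pat@(perm , _) pat′ = lookup-ext λ i →
    trans (sym (firstLetter-lookup w π pat i))
      (trans (labelling-unique (cycleOf π) (des-cycle≢0 2≤N (cycleOf-IsPerm π perm) (cycleOf-IsNCycle π perm))
                {firstLetter w π pat} {firstLetter w′ π pat′}
                (firstLetter-labelling w π pat) (firstLetter-labelling w′ π pat′) (lookup π i))
        (firstLetter-lookup w′ π pat′ i))

  -- Itineraries of a labelled cycle

  module _ (τ : Vec (Fin N) N) (perm : IsPerm τ) (cyc : IsNCycle τ) (ℓ : Fin N → Letter) (labelling : Labelling τ ℓ) (x : Fin N) where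

    itinerary : Vec Letter N
    itinerary = prefix (λ k → ℓ (iter τ k x)) N

    periodic-itinerary : ∀ k → periodic itinerary k ≡ ℓ (iter τ k x)
    periodic-itinerary k = trans (periodic-prefix (λ k → ℓ (iter τ k x)) n k) (cong ℓ (iter-% τ (iter-n perm cyc x) k))

    private
      S = shiftAt itinerary

    -- While the letters agree, both points lie in one block, where `τ` is increasing, and strictly
    -- so by injectivity.
    iter-<-persists : ∀ a b → iter τ a x Fin.< iter τ b x → ∀ j → (∀ i → i < j → S a i ≡ S b i) →
                      iter τ (a + j) x Fin.< iter τ (b + j) x
    iter-<-persists a b lt zero    eq = subst₂ (λ a b → iter τ a x Fin.< iter τ b x)
      (sym (ℕ.+-identityʳ a)) (sym (ℕ.+-identityʳ b)) lt
    iter-<-persists a b lt (suc j) eq = subst₂ (λ a b → iter τ a x Fin.< iter τ b x)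
      (sym (ℕ.+-suc a j)) (sym (ℕ.+-suc b j))
      (ℕ.≤∧≢⇒< (proj₂ labelling _ _ (ℕ.<⇒≤ ih)
                  (trans (sym (periodic-itinerary (a + j))) (trans (eq j ℕ.≤-refl) (periodic-itinerary (b + j)))))
        (λ e → ℕ.<-irrefl (cong toℕ (perm _ _ (Fin.toℕ-injective e))) ih))
      where
      ih : iter τ (a + j) x Fin.< iter τ (b + j) x
      ih = iter-<-persists a b lt j λ i i<j → eq i (ℕ.m<n⇒m<1+n i<j)

    -- Otherwise, with iter τ b x = τᵐ y for y = iter τ a x, the sequence
    -- y < τᵐ y < τ²ᵐ y < … would increase forever.
    iter-<⇒distinct : ∀ a b → iter τ a x Fin.< iter τ b x → ¬ (∀ k → S a k ≡ S b k)
    -- The chain is followed for `N` rounds: the exponent has then grown by `N * m`, a multiple of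
    -- the full turn, and the chain is back at its start.
    iter-<⇒distinct a b lt eq = ℕ.<-irrefl (cong toℕ (sym (trans (cong (λ c → iter τ c x) (cong (_+_ a) (ℕ.*-comm N m)))
        (iter-* τ (iter-n perm cyc x) a m))))
      (ℕ.≤-<-trans (climb n) (step n))
      where
      m = proj₁ (cyc (iter τ a x) (iter τ b x))
      τᵐ : ∀ c → iter τ (b + c) x ≡ iter τ (a + (m + c)) x
      τᵐ c = begin
        iter τ (b + c) x                    ≡⟨ cong (λ k → iter τ k x) (ℕ.+-comm b c) ⟩
        iter τ (c + b) x                    ≡⟨ iter-+ τ c b x ⟩
        iter τ c (iter τ b x)               ≡⟨ cong (iter τ c) (proj₂ (cyc (iter τ a x) (iter τ b x))) ⟨
        iter τ c (iter τ m (iter τ a x))    ≡⟨ iter-+ τ c m (iter τ a x) ⟨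
        iter τ (c + m) (iter τ a x)         ≡⟨ iter-+ τ (c + m) a x ⟨
        iter τ (c + m + a) x                ≡⟨ cong (λ k → iter τ k x) (trans (ℕ.+-comm (c + m) a) (cong (_+_ a) (ℕ.+-comm c m))) ⟩
        iter τ (a + (m + c)) x              ∎
        where open ≡-Reasoning
      step : ∀ r → iter τ (a + r * m) x Fin.< iter τ (a + suc r * m) x
      step r = subst (iter τ (a + r * m) x Fin.<_) (τᵐ (r * m)) (iter-<-persists a b lt (r * m) λ i _ → eq i)
      climb : ∀ r → iter τ a x Fin.≤ iter τ (a + r * m) x
      climb zero    = ℕ.≤-reflexive (cong (λ c → toℕ (iter τ c x)) (sym (ℕ.+-identityʳ a)))
      climb (suc r) = ℕ.≤-trans (climb r) (ℕ.<⇒≤ (step r))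

    -- At the first difference the iterates are still in their original order, and monotonicity of
    -- the labels puts the letters in that order too.
    iter-<⇒≺ : ∀ a b → iter τ a x Fin.< iter τ b x → S a ≺ S b
    iter-<⇒≺ a b lt with shiftAt-compare itinerary a b
    ... | inj₁ a≺b = a≺b
    ... | inj₂ (inj₂ eq) = contradiction eq (iter-<⇒distinct a b lt)
    ... | inj₂ (inj₁ (j , eq , Sbj<Saj)) = contradiction Sbj<Saj (ℕ.≤⇒≯
            (subst₂ Fin._≤_ (sym (periodic-itinerary (a + j))) (sym (periodic-itinerary (b + j)))
              (proj₁ labelling _ _ (ℕ.<⇒≤ (iter-<-persists a b lt j λ i i<j → sym (eq i i<j))))))

    iter-≺⇒< : ∀ a b → S a ≺ S b → iter τ a x Fin.< iter τ b x
    iter-≺⇒< a b a≺b with ℕ.<-cmp (toℕ (iter τ a x)) (toℕ (iter τ b x))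
    ... | tri< lt _ _ = lt
    ... | tri> _ _ gt = contradiction a≺b (≺-asym (iter-<⇒≺ b a gt))
    ... | tri≈ _ eq _ = contradiction a≺b (≺-irrefl λ k → begin
      S a k                        ≡⟨ periodic-itinerary (a + k) ⟩
      ℓ (iter τ (a + k) x)         ≡⟨ cong ℓ (split a k) ⟩
      ℓ (iter τ k (iter τ a x))    ≡⟨ cong (ℓ ∘ iter τ k) (Fin.toℕ-injective eq) ⟩
      ℓ (iter τ k (iter τ b x))    ≡⟨ cong ℓ (split b k) ⟨
      ℓ (iter τ (b + k) x)         ≡⟨ periodic-itinerary (b + k) ⟨
      S b k                        ∎)
      where
      open ≡-Reasoning
      split : ∀ a k → iter τ (a + k) x ≡ iter τ k (iter τ a x)
      split a k = trans (cong (λ c → iter τ c x) (ℕ.+-comm a k)) (iter-+ τ k a x)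

    itinerary-IsPattern : IsPattern itinerary (orbit τ x)
    itinerary-IsPattern = orbit-IsPerm τ perm cyc x , λ i j → mk⇔
      (iter-<⇒≺ (toℕ i) (toℕ j) ∘ subst₂ Fin._<_ (lookup-orbit τ x i) (lookup-orbit τ x j))
      (subst₂ Fin._<_ (sym (lookup-orbit τ x i)) (sym (lookup-orbit τ x j)) ∘ iter-≺⇒< (toℕ i) (toℕ j))

    -- A shorter period `p` would give `x` and its `p`-th iterate, which are distinct points, the
    -- same itinerary.
    itinerary-aperiodic : Aperiodic itinerary
    itinerary-aperiodic p 0<p p<N per with ℕ.<-cmp (toℕ (iter τ 0 x)) (toℕ (iter τ p x))
    ... | tri< lt _ _ = iter-<⇒distinct 0 p lt λ k → sym (trans (cong (periodic itinerary) (ℕ.+-comm p k)) (per k))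
    ... | tri≈ _ eq _ = iter-distinct τ perm cyc x 0<p p<N (Fin.toℕ-injective eq)
    ... | tri> _ _ gt = iter-<⇒distinct p 0 gt λ k → trans (cong (periodic itinerary) (ℕ.+-comm p k)) (per k)

  -- Counting the patterns in two ways

  orbit-InPn : ∀ τ → CycDes N 2 τ → ∀ x → InPn N (orbit τ x)
  orbit-InPn τ (perm , cyc , des≡1) x = let ℓ , lab = des≡1⇒labelling τ des≡1 in
    itinerary τ perm cyc ℓ lab x ,
    aperiodic⇒primitive _ (itinerary-aperiodic τ perm cyc ℓ lab x) ,
    itinerary-IsPattern τ perm cyc ℓ lab x

  Card-InPn : 2 ≤ N → ∀ {m} → Card (λ (w : Vec Letter N) → Primitive (toList w)) m → Card (InPn N) m
  Card-InPn 2≤N = Card-bijection patternOf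
    (λ {w} prim → w , prim , isPattern w prim)
    (λ {w} {w′} prim prim′ eq → word-determined 2≤N w w′ (patternOf w)
      (isPattern w prim) (subst (IsPattern w′) (sym eq) (isPattern w′ prim′)))
    (λ {π} (w , prim , pat) → w , prim , IsPattern-unique w (patternOf w) π (isPattern w prim) pat)
    where
    isPattern : ∀ (w : Vec Letter N) → Primitive (toList w) → IsPattern w (patternOf w)
    isPattern w prim = patternOf-IsPattern w (primitive⇒aperiodic w prim)

  -- Each cycle comes from several patterns, one for each starting point. Starting at 0 shows that
  -- every cycle occurs.
  Card-CycDes : 2 ≤ N → ∀ {m} → Card (InPn N) m → ∃[ c ] Card (CycDes N 2) c
  Card-CycDes 2≤N = Card-image (Vec.≡-dec Fin._≟_) cycleOf
    (λ {π} (w , _ , pat) → cycleOf-CycDes w π pat 2≤N)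
    (λ {τ} cd@(perm , cyc , _) → orbit τ Fin.zero , orbit-InPn τ cd Fin.zero , cycleOf-orbit τ perm cyc Fin.zero)

  -- The inverse sends `π` to `cycleOf π` and its first entry; the orbits of one cycle are the
  -- rotations of a single pattern.
  Card-InPn-orbits : 2 ≤ N → ∀ {c} → Card (CycDes N 2) c → Card (InPn N) (c * N)
  Card-InPn-orbits 2≤N card = Card-bijection (λ (τ , x) → orbit τ x)
    (λ {(τ , x)} (cd , _) → orbit-InPn τ cd x)
    (λ {(τ , x)} {(τ′ , x′)} ((perm , cyc , _) , _) ((perm′ , cyc′ , _) , _) eq → cong₂ _,_
      (trans (sym (cycleOf-orbit τ perm cyc x)) (trans (cong cycleOf eq) (cycleOf-orbit τ′ perm′ cyc′ x′)))
      (cong (λ π → lookup π Fin.zero) eq))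
    (λ {π} (w , _ , pat@(perm , _)) → (cycleOf π , lookup π Fin.zero) , (cycleOf-CycDes w π pat 2≤N , tt) , orbit-cycleOf π perm)
    (Card-× card (Card-Fin N))

theorem3p7 : (n : ℕ) → (h : 2 ≤ n) →
    ∃[ c ] (HasCard n (CycDes n 2) c ×
    HasCard n (InPn n) (n * c) ×
    (+ n) Data.Integer.* (+ c) ≡ necklaceSum n)
theorem3p7 n@(suc n′) 2≤n =
  c , cycDes , inPn , (begin
    (+ n) ℤ.* (+ c)    ≡⟨ ℤ.pos-* n c ⟨
    + (n * c)          ≡⟨ cong +_ (Card-unique inPn patterns) ⟩
    + _                ≡⟨ necklaceSum-counts-primitive n′ ⟨
    necklaceSum n      ∎)
  where
  open ≡-Reasoning
  patterns : Card (InPn n) _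
  patterns = Card-InPn 2≤n (Card-filter primitive?)
  c = proj₁ (Card-CycDes 2≤n patterns)
  cycDes = proj₂ (Card-CycDes 2≤n patterns)
  inPn : Card (InPn n) (n * c)
  inPn = subst (Card (InPn n)) (ℕ.*-comm c n) (Card-InPn-orbits 2≤n cycDes)
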